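{- Let $g\geq1$ and $n\geq1$ be integers and let $1\leq h\leq n$. There is a bijection $\phi:\mathfrak{S}_{n-1}\times\{0,1,\dots,n-1\}\to\mathfrak{S}_n$ such that for all $\sigma\in\mathfrak{S}_{n-1}$ and $0\leq c\leq n-1$: $$g\mathsf{Exclp}_h(\phi(\sigma,c))=\begin{cases}g\mathsf{Exclp}_h(\sigma),& 0\leq c\leq |g\mathsf{Exclp}_h(\sigma)|+g-1,\\ g\mathsf{Exclp}_h(\sigma)\cup\{k_d\},&\text{otherwise,}\end{cases}\qquad g\mathsf{den}_h(\phi(\sigma,c))=g\mathsf{den}_h(\sigma)+c,$$ where $d=c-|g\mathsf{Exclp}_h(\sigma)|-g+1$ and $k_d$ is the $d$-th smallest element of $[n-1]\setminus g\mathsf{Exclp}_h(\sigma)$.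
   Context: Permutations $\pi\in\mathfrak{S}_m$ are in one-line notation $\pi_1\cdots\pi_m$. $g\mathsf{Exclp}_h(\pi)=\{i\in[m]:\pi_i\geq i+g,\ \pi_i\geq h\}$ (the $g$-gap $h$-level excedance-letter positions). Let $g\mathrm{EXCL}_h(\pi)$ be the subsequence of $\pi$ of letters $\pi_i$ with $i\in g\mathsf{Exclp}_h(\pi)$ and $g\mathrm{NEXCL}_h(\pi)$ the subsequence of the remaining letters. For a word $u$ of distinct integers, $\mathsf{inv}(u)$ counts pairs of positions $i<j$ with $u_i>u_j$. Then $g\mathsf{den}_h(\pi)=\sum_{i\in g\mathsf{Exclp}_h(\pi)}(i+g-1)+\mathsf{inv}(g\mathrm{EXCL}_h(\pi))+\mathsf{inv}(g\mathrm{NEXCL}_h(\pi))$. -}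

module Defs where

open import Data.Nat using (ℕ; zero; suc; _+_; _∸_; _≤ᵇ_; _<ᵇ_)
open import Data.Bool using (Bool; true; false; if_then_else_; _∧_)
open import Data.List using (List; []; _∷_; length; map; upTo)
open import Data.Nat.ListAction using (sum)
open import Data.List.Membership.Propositional using (_∈_)
open import Data.List.Relation.Binary.Permutation.Propositional using (_↭_)
open import Data.Maybe using (Maybe; just; nothing)

-- A permutation of [m] in one-line notation: a word that is a rearrangement of 1,2,...,m.
IsPerm : ℕ → List ℕ → Set
IsPerm m w = w ↭ map suc (upTo m)

-- Test whether position i (1-indexed) with letter x belongs to gExclp_h:
-- x ≥ i + g and x ≥ h.
isExc : ℕ → ℕ → ℕ → ℕ → Bool
isExc g h i x = ((i + g) ≤ᵇ x) ∧ (h ≤ᵇ x)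

exclpFrom : ℕ → ℕ → ℕ → List ℕ → List ℕ
exclpFrom g h i [] = []
exclpFrom g h i (x ∷ xs) =
  if isExc g h i x then i ∷ exclpFrom g h (suc i) xs else exclpFrom g h (suc i) xs

exclp : ℕ → ℕ → List ℕ → List ℕ
exclp g h π = exclpFrom g h 1 π

EXCLFrom : ℕ → ℕ → ℕ → List ℕ → List ℕ
EXCLFrom g h i [] = []
EXCLFrom g h i (x ∷ xs) =
  if isExc g h i x then x ∷ EXCLFrom g h (suc i) xs else EXCLFrom g h (suc i) xs

NEXCLFrom : ℕ → ℕ → ℕ → List ℕ → List ℕ
NEXCLFrom g h i [] = []
NEXCLFrom g h i (x ∷ xs) =
  if isExc g h i x then NEXCLFrom g h (suc i) xs else x ∷ NEXCLFrom g h (suc i) xs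

countLess : ℕ → List ℕ → ℕ
countLess x [] = 0
countLess x (y ∷ ys) = (if y <ᵇ x then 1 else 0) + countLess x ys

inv : List ℕ → ℕ
inv [] = 0
inv (x ∷ xs) = countLess x xs + inv xs

den : ℕ → ℕ → List ℕ → ℕ
den g h π = sum (map (λ i → i + g ∸ 1) (exclp g h π))
          + inv (EXCLFrom g h 1 π) + inv (NEXCLFrom g h 1 π)

memb : ℕ → List ℕ → Bool
memb x [] = false
memb x (y ∷ ys) = if (x ≤ᵇ y) ∧ (y ≤ᵇ x) then true else memb x ys

complementIn : ℕ → List ℕ → List ℕ
complementIn m S = go (map suc (upTo m))
  where
  go : List ℕ → List ℕ
  go [] = []
  go (x ∷ xs) = if memb x S then go xs else x ∷ go xs

nth : List ℕ → ℕ → Maybe ℕ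
nth [] _ = nothing
nth (x ∷ xs) zero = just x
nth (x ∷ xs) (suc k) = nth xs k

dthSmallestNotIn : ℕ → List ℕ → ℕ → Maybe ℕ
dthSmallestNotIn m S d = nth (complementIn m S) (d ∸ 1)

{-# OPTIONS --safe #-}
-- Write e = |gExclp_h σ|.  The map φ(σ, c) inserts the letter n into σ in one of three ways,
-- according as c < g, g ≤ c < e + g or e + g ≤ c, and in each regime the new excedance set and
-- the new inversions of the two subwords gEXCL_h and gNEXCL_h can be read off directly, which
-- gives the change c of den.  A permutation is handled through its excedance flags together with
-- its excedance and non-excedance subwords, from which it is rebuilt by interleaving.  The map
-- is injective because an explicit ψ recovers (σ, c) from φ(σ, c): the regime is visible from
-- where n sits.  Surjectivity is then counting: an injection from S_{n-1} × {0,…,n-1} into S_n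
-- is onto, both sets having n! elements (enumerated here as duplicate-free lists).
module Submission where

open import Defs
open import Data.Bool using (Bool; true; false; if_then_else_; _∧_; _∨_)
open import Data.Bool.Properties using (∨-zeroʳ)
open import Data.Empty using (⊥; ⊥-elim)
open import Data.List using (List; []; _∷_; _++_; [_]; length; map; upTo; take; drop)
open import Data.List.Membership.Propositional using (_∈_; _∉_)
open import Data.List using (cartesianProduct; applyUpTo)
open import Data.List.Membership.Propositional.Properties using (∈-map⁺; ∈-map⁻; ∈-++⁺ˡ; ∈-++⁺ʳ; ∈-++⁻; ∈-∃++; ∈-cartesianProduct⁺; ∈-cartesianProduct⁻; ∈-upTo⁺; ∈-upTo⁻)
open import Data.List.Properties using (++-assoc; ++-identityʳ; length-++; length-map; map-++; map-upTo; length-upTo; take++drop≡id; take-all; ≡-dec; length-take; length-drop; upTo-∷ʳ)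
open import Data.List.Relation.Binary.Permutation.Propositional as ↭ using (_↭_; ↭-sym; ↭-trans; module PermutationReasoning)
open import Data.List.Relation.Binary.Permutation.Propositional.Properties using (↭-length; ↭-empty-inv; All-resp-↭; ∈-resp-↭; shift; drop-∷; ++⁺ˡ; ++⁺ʳ; ∷↭∷ʳ; map⁺)
open import Data.List.Relation.Binary.Subset.Propositional using (_⊆_)
open import Data.List.Relation.Unary.All as All using (All; []; _∷_)
open import Data.List.Relation.Unary.All.Properties using (++⁺; ++⁻; take⁺; drop⁺; applyUpTo⁺₁; All¬⇒¬Any) renaming (map⁺ to All-map⁺)
open import Data.List.Relation.Unary.Any using (here; there)
open import Data.List.Relation.Unary.Unique.Propositional using (Unique; []; _∷_)
open import Data.List.Relation.Unary.Unique.Propositional.Properties using (cartesianProduct⁺; upTo⁺)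
open import Data.Maybe using (just)
open import Data.Maybe.Properties using (just-injective)
open import Data.Nat using (ℕ; zero; suc; _+_; _∸_; _≤_; _<_; _≤ᵇ_; _<ᵇ_; _≡ᵇ_; _⊔_; z≤n; s≤s; s≤s⁻¹; _≟_; _<?_)
open import Data.Nat.ListAction using (sum)
open import Data.Nat.ListAction.Properties using (sum-↭)
open import Data.Nat.Properties
open import Data.Nat.Tactic.RingSolver using (solve-∀)
open import Data.Product using (Σ; ∃; ∃₂; _×_; _,_; proj₁; proj₂; uncurry)
open import Data.Sum using (_⊎_; inj₁; inj₂)
open import Data.Unit using (⊤; tt)
open import Function.Base using (_∘_)
open import Function.Bundles using (_⇔_; mk⇔)
open import Relation.Nullary using (¬_; yes; no)
open import Relation.Nullary.Reflects using (Reflects; ofʸ; ofⁿ; det; fromEquivalence; _×-reflects_)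
open import Relation.Binary.Definitions using (DecidableEquality)
open import Relation.Binary.PropositionalEquality using (_≡_; _≢_; refl; sym; cong; cong₂; subst; trans; module ≡-Reasoning)

module _ {a} {A : Set a} where

  reflects-yes : ∀ {b} → Reflects A b → A → b ≡ true
  reflects-yes r p = det r (ofʸ p)

  reflects-no : ∀ {b} → Reflects A b → ¬ A → b ≡ false
  reflects-no r ¬p = det r (ofⁿ ¬p)

  reflects-true : ∀ {b} → Reflects A b → b ≡ true → A
  reflects-true (ofʸ p) _ = p

  reflects-false : ∀ {b} → Reflects A b → b ≡ false → ¬ A
  reflects-false (ofⁿ ¬p) _ = ¬p

cong₃ : ∀ {A B C D : Set} (f : A → B → C → D) {a a′ b b′ c c′} → a ≡ a′ → b ≡ b′ → c ≡ c′ → f a b c ≡ f a′ b′ c′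
cong₃ f refl refl refl = refl

≡ᵇ-reflects-≡ : ∀ m n → Reflects (m ≡ n) (m ≡ᵇ n)
≡ᵇ-reflects-≡ m n = fromEquivalence (≡ᵇ⇒≡ m n) (≡⇒≡ᵇ m n)

countᵇ : (ℕ → Bool) → List ℕ → ℕ
countᵇ p [] = 0
countᵇ p (x ∷ xs) = (if p x then 1 else 0) + countᵇ p xs

countᵇ-++ : ∀ p xs ys → countᵇ p (xs ++ ys) ≡ countᵇ p xs + countᵇ p ys
countᵇ-++ p [] ys = refl
countᵇ-++ p (x ∷ xs) ys =
  trans (cong (px +_) (countᵇ-++ p xs ys)) (sym (+-assoc px (countᵇ p xs) (countᵇ p ys)))
  where
  px : ℕ
  px = if p x then 1 else 0

countᵇ-↭ : ∀ p {xs ys} → xs ↭ ys → countᵇ p xs ≡ countᵇ p ys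
countᵇ-↭ p ↭.refl = refl
countᵇ-↭ p (↭.prep x q) = cong ((if p x then 1 else 0) +_) (countᵇ-↭ p q)
countᵇ-↭ p (↭.swap {xs} x y q) =
  trans (+-exchange px py (countᵇ p xs)) (cong (λ k → py + (px + k)) (countᵇ-↭ p q))
  where
  px py : ℕ
  px = if p x then 1 else 0
  py = if p y then 1 else 0
  +-exchange : ∀ a b c → a + (b + c) ≡ b + (a + c)
  +-exchange = solve-∀
countᵇ-↭ p (↭.trans q r) = trans (countᵇ-↭ p q) (countᵇ-↭ p r)

countᵇ-none : ∀ p {xs} → All (λ x → p x ≡ false) xs → countᵇ p xs ≡ 0
countᵇ-none p [] = refl
countᵇ-none p (px ∷ pxs) rewrite px = countᵇ-none p pxs

countᵇ-all : ∀ p {xs} → All (λ x → p x ≡ true) xs → countᵇ p xs ≡ length xs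
countᵇ-all p [] = refl
countᵇ-all p (px ∷ pxs) rewrite px = cong suc (countᵇ-all p pxs)

countGt : ℕ → List ℕ → ℕ
countGt x = countᵇ (x <ᵇ_)

countEq : ℕ → List ℕ → ℕ
countEq x = countᵇ (_≡ᵇ x)

countLess≡countᵇ : ∀ x xs → countLess x xs ≡ countᵇ (_<ᵇ x) xs
countLess≡countᵇ x [] = refl
countLess≡countᵇ x (y ∷ xs) = cong ((if y <ᵇ x then 1 else 0) +_) (countLess≡countᵇ x xs)

countLess-++ : ∀ x xs ys → countLess x (xs ++ ys) ≡ countLess x xs + countLess x ys
countLess-++ x xs ys = begin
  countLess x (xs ++ ys)                      ≡⟨ countLess≡countᵇ x (xs ++ ys) ⟩
  countᵇ (_<ᵇ x) (xs ++ ys)                   ≡⟨ countᵇ-++ (_<ᵇ x) xs ys ⟩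
  countᵇ (_<ᵇ x) xs + countᵇ (_<ᵇ x) ys       ≡⟨ cong₂ _+_ (countLess≡countᵇ x xs) (countLess≡countᵇ x ys) ⟨
  countLess x xs + countLess x ys             ∎
  where open ≡-Reasoning

countLess-none : ∀ x {xs} → All (x ≤_) xs → countLess x xs ≡ 0
countLess-none x {xs} x≤xs = trans (countLess≡countᵇ x xs)
  (countᵇ-none (_<ᵇ x) (All.map (λ x≤y → reflects-no (<ᵇ-reflects-< _ x) (≤⇒≯ x≤y)) x≤xs))

countLess-all : ∀ x {xs} → All (_< x) xs → countLess x xs ≡ length xs
countLess-all x {xs} xs<x = trans (countLess≡countᵇ x xs)
  (countᵇ-all (_<ᵇ x) (All.map (reflects-yes (<ᵇ-reflects-< _ x)) xs<x))

countGt-none : ∀ x {xs} → All (_≤ x) xs → countGt x xs ≡ 0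
countGt-none x xs≤x = countᵇ-none (x <ᵇ_) (All.map (λ y≤x → reflects-no (<ᵇ-reflects-< x _) (≤⇒≯ y≤x)) xs≤x)

countGt-all : ∀ x {xs} → All (x <_) xs → countGt x xs ≡ length xs
countGt-all x x<xs = countᵇ-all (x <ᵇ_) (All.map (reflects-yes (<ᵇ-reflects-< x _)) x<xs)

countEq-none : ∀ x {xs} → All (_≢ x) xs → countEq x xs ≡ 0
countEq-none x xs≢x = countᵇ-none (_≡ᵇ x) (All.map (reflects-no (≡ᵇ-reflects-≡ _ x)) xs≢x)

countLess+countGt+countEq : ∀ x xs → countLess x xs + countGt x xs + countEq x xs ≡ length xs
countLess+countGt+countEq x [] = refl
countLess+countGt+countEq x (y ∷ xs) = begin
  (l + countLess x xs) + (r + countGt x xs) + (e + countEq x xs)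
    ≡⟨ regroup l r e (countLess x xs) (countGt x xs) (countEq x xs) ⟩
  (l + r + e) + (countLess x xs + countGt x xs + countEq x xs)
    ≡⟨ cong₂ _+_ (trichotomy y x) (countLess+countGt+countEq x xs) ⟩
  suc (length xs) ∎
  where
  open ≡-Reasoning
  l r e : ℕ
  l = if y <ᵇ x then 1 else 0
  r = if x <ᵇ y then 1 else 0
  e = if y ≡ᵇ x then 1 else 0
  regroup : ∀ a b c d e f → a + d + (b + e) + (c + f) ≡ (a + b + c) + (d + e + f)
  regroup = solve-∀
  trichotomy : ∀ y x → (if y <ᵇ x then 1 else 0) + (if x <ᵇ y then 1 else 0) + (if y ≡ᵇ x then 1 else 0) ≡ 1
  trichotomy zero zero = refl
  trichotomy zero (suc x) = refl
  trichotomy (suc y) zero = refl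
  trichotomy (suc y) (suc x) = trichotomy y x

inv-insert : ∀ xs x ys → inv (xs ++ x ∷ ys) ≡ countGt x xs + countLess x ys + inv (xs ++ ys)
inv-insert [] x ys = refl
inv-insert (y ∷ xs) x ys
  rewrite inv-insert xs x ys | countLess-++ y xs (x ∷ ys) | countLess-++ y xs ys =
  regroup (countLess y xs) (if x <ᵇ y then 1 else 0) (countLess y ys) (countGt x xs) (countLess x ys) (inv (xs ++ ys))
  where
  regroup : ∀ p q r s t u → p + (q + r) + (s + t + u) ≡ q + s + t + (p + r + u)
  regroup = solve-∀

range : ℕ → List ℕ
range N = map suc (upTo N)

range-suc : ∀ N → range (suc N) ↭ suc N ∷ range N
range-suc N = begin
  map suc (upTo (suc N))     ≡⟨ cong (map suc) (upTo-∷ʳ N) ⟨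
  map suc (upTo N ++ [ N ])  ≡⟨ map-++ suc (upTo N) [ N ] ⟩
  range N ++ [ suc N ]       ↭⟨ ∷↭∷ʳ (suc N) (range N) ⟨
  suc N ∷ range N            ∎
  where open PermutationReasoning

range-bounded : ∀ N → All (λ x → 1 ≤ x × x ≤ N) (range N)
range-bounded N = subst (All _) (sym (map-upTo suc N)) (applyUpTo⁺₁ suc N (λ i<N → s≤s z≤n , i<N))

perm-bounded : ∀ {N σ} → σ ↭ range N → All (λ x → 1 ≤ x × x ≤ N) σ
perm-bounded {N} σ↭ = All-resp-↭ (↭-sym σ↭) (range-bounded N)

perm-length : ∀ {N σ} → σ ↭ range N → length σ ≡ N
perm-length {N} σ↭ = trans (↭-length σ↭) (trans (length-map suc (upTo N)) (length-upTo N))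

countGt-range : ∀ y N → countGt y (range N) ≡ N ∸ y
countGt-range y zero = sym (0∸n≡0 y)
countGt-range y (suc N) with y <? suc N
... | yes y<1+N = begin
  countGt y (range (suc N))        ≡⟨ countᵇ-↭ (y <ᵇ_) (range-suc N) ⟩
  countGt y (suc N ∷ range N)      ≡⟨ cong (λ b → (if b then 1 else 0) + countGt y (range N)) (reflects-yes (<ᵇ-reflects-< y _) y<1+N) ⟩
  suc (countGt y (range N))        ≡⟨ cong suc (countGt-range y N) ⟩
  suc (N ∸ y)                      ≡⟨ +-∸-assoc 1 (s≤s⁻¹ y<1+N) ⟨
  suc N ∸ y                        ∎
  where open ≡-Reasoning
... | no y≮1+N = begin
  countGt y (range (suc N))        ≡⟨ countᵇ-↭ (y <ᵇ_) (range-suc N) ⟩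
  countGt y (suc N ∷ range N)      ≡⟨ cong (λ b → (if b then 1 else 0) + countGt y (range N)) (reflects-no (<ᵇ-reflects-< y _) y≮1+N) ⟩
  countGt y (range N)              ≡⟨ countGt-range y N ⟩
  N ∸ y                            ≡⟨ m≤n⇒m∸n≡0 (≤-trans (n≤1+n N) (≮⇒≥ y≮1+N)) ⟩
  0                                ≡⟨ m≤n⇒m∸n≡0 (≮⇒≥ y≮1+N) ⟨
  suc N ∸ y                        ∎
  where open ≡-Reasoning

countEq-range : ∀ y N → 1 ≤ y → y ≤ N → countEq y (range N) ≡ 1
countEq-range (suc y) zero _ ()
countEq-range y (suc N) 1≤y y≤1+N = trans (countᵇ-↭ (_≡ᵇ y) (range-suc N)) (head-case (m≤n⇒m<n∨m≡n y≤1+N))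
  where
  head-case : y < suc N ⊎ y ≡ suc N → countEq y (suc N ∷ range N) ≡ 1
  head-case (inj₁ y<1+N)
    rewrite reflects-no (≡ᵇ-reflects-≡ (suc N) y) (>⇒≢ y<1+N) = countEq-range y N 1≤y (s≤s⁻¹ y<1+N)
  head-case (inj₂ refl)
    rewrite reflects-yes (≡ᵇ-reflects-≡ y y) refl =
    cong suc (countEq-none y (All.map (λ bounds → <⇒≢ (s≤s (proj₂ bounds))) (range-bounded N)))

countᵇ-around : ∀ p y A C Y₁ Y₂ → countᵇ p (A ++ y ∷ C ++ Y₁ ++ Y₂) ≡
                countᵇ p A + ((if p y then 1 else 0) + (countᵇ p C + (countᵇ p Y₁ + countᵇ p Y₂)))
countᵇ-around p y A C Y₁ Y₂ = trans (countᵇ-++ p A _)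
  (cong (λ k → countᵇ p A + ((if p y then 1 else 0) + k)) (trans (countᵇ-++ p C _) (cong (countᵇ p C +_) (countᵇ-++ p Y₁ Y₂))))

countGt-around : ∀ {N y} A C Y₁ Y₂ → A ++ y ∷ C ++ Y₁ ++ Y₂ ↭ range N → All (y <_) C → All (_< y) Y₁ →
                 countGt y A + length C + countGt y Y₂ + y ≡ N
countGt-around {N} {y} A C Y₁ Y₂ L↭ C>y Y₁<y = begin
  countGt y A + length C + countGt y Y₂ + y
    ≡⟨ cong (_+ y) (+-assoc (countGt y A) _ _) ⟩
  countGt y A + (length C + countGt y Y₂) + y
    ≡⟨ cong (λ k → countGt y A + (k + countGt y Y₂) + y) (countGt-all y C>y) ⟨
  countGt y A + (countGt y C + (0 + countGt y Y₂)) + y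
    ≡⟨ cong (λ k → countGt y A + (countGt y C + (k + countGt y Y₂)) + y) (countGt-none y (All.map <⇒≤ Y₁<y)) ⟨
  countGt y A + (countGt y C + (countGt y Y₁ + countGt y Y₂)) + y
    ≡⟨ cong (λ b → countGt y A + ((if b then 1 else 0) + (countGt y C + (countGt y Y₁ + countGt y Y₂))) + y)
            (reflects-no (<ᵇ-reflects-< y y) (<-irrefl refl)) ⟨
  countGt y A + ((if y <ᵇ y then 1 else 0) + (countGt y C + (countGt y Y₁ + countGt y Y₂))) + y
    ≡⟨ cong (_+ y) (countᵇ-around (y <ᵇ_) y A C Y₁ Y₂) ⟨
  countGt y (A ++ y ∷ C ++ Y₁ ++ Y₂) + y
    ≡⟨ cong (_+ y) (trans (countᵇ-↭ (y <ᵇ_) L↭) (countGt-range y N)) ⟩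
  N ∸ y + y
    ≡⟨ m∸n+n≡m (proj₂ (All.lookup (perm-bounded L↭) (∈-++⁺ʳ A (here refl)))) ⟩
  N ∎
  where open ≡-Reasoning

countEq-around : ∀ {N y} A C Y₁ Y₂ → A ++ y ∷ C ++ Y₁ ++ Y₂ ↭ range N → All (y <_) C → All (_< y) Y₁ →
                 countEq y Y₂ ≡ 0
countEq-around {N} {y} A C Y₁ Y₂ L↭ C>y Y₁<y = m+n≡0⇒n≡0 (countEq y A) (suc-injective (begin
  suc (countEq y A + countEq y Y₂)
    ≡⟨ +-suc (countEq y A) _ ⟨
  countEq y A + suc (countEq y Y₂)
    ≡⟨ cong (λ k → countEq y A + suc k) (cong₂ _+_ (countEq-none y (All.map >⇒≢ C>y))
                                                    (cong (_+ countEq y Y₂) (countEq-none y (All.map <⇒≢ Y₁<y)))) ⟨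
  countEq y A + suc (countEq y C + (countEq y Y₁ + countEq y Y₂))
    ≡⟨ cong (λ b → countEq y A + ((if b then 1 else 0) + (countEq y C + (countEq y Y₁ + countEq y Y₂))))
            (reflects-yes (≡ᵇ-reflects-≡ y y) refl) ⟨
  countEq y A + ((if y ≡ᵇ y then 1 else 0) + (countEq y C + (countEq y Y₁ + countEq y Y₂)))
    ≡⟨ countᵇ-around (_≡ᵇ y) y A C Y₁ Y₂ ⟨
  countEq y (A ++ y ∷ C ++ Y₁ ++ Y₂)
    ≡⟨ countᵇ-↭ (_≡ᵇ y) L↭ ⟩
  countEq y (range N)
    ≡⟨ countEq-range y N (proj₁ y-bounds) (proj₂ y-bounds) ⟩
  1 ∎))
  where
  open ≡-Reasoning
  y-bounds : 1 ≤ y × y ≤ N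
  y-bounds = All.lookup (perm-bounded L↭) (∈-++⁺ʳ A (here refl))

take-length : ∀ {A : Set} {k} (xs : List A) → k ≤ length xs → length (take k xs) ≡ k
take-length {k = k} xs k≤ = trans (length-take k xs) (m≤n⇒m⊓n≡m k≤)

take-++ˡ : ∀ {A : Set} k (xs ys : List A) → k ≤ length xs → take k (xs ++ ys) ≡ take k xs
take-++ˡ zero xs ys _ = refl
take-++ˡ (suc k) (x ∷ xs) ys (s≤s k≤) = cong (x ∷_) (take-++ˡ k xs ys k≤)

take-length-++ : ∀ {A : Set} (xs ys : List A) → take (length xs) (xs ++ ys) ≡ xs
take-length-++ xs ys = trans (take-++ˡ (length xs) xs ys ≤-refl) (take-all (length xs) xs ≤-refl)

insertAt : ℕ → ℕ → List ℕ → List ℕ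
insertAt zero v xs = v ∷ xs
insertAt (suc k) v [] = [ v ]
insertAt (suc k) v (x ∷ xs) = x ∷ insertAt k v xs

removeAt : ℕ → List ℕ → List ℕ
removeAt k [] = []
removeAt zero (x ∷ xs) = xs
removeAt (suc k) (x ∷ xs) = x ∷ removeAt k xs

indexOf : ℕ → List ℕ → ℕ
indexOf v [] = 0
indexOf v (x ∷ xs) = if x ≡ᵇ v then 0 else suc (indexOf v xs)

insertAt≡take++drop : ∀ k v xs → insertAt k v xs ≡ take k xs ++ v ∷ drop k xs
insertAt≡take++drop zero v xs = refl
insertAt≡take++drop (suc k) v [] = refl
insertAt≡take++drop (suc k) v (x ∷ xs) = cong (x ∷_) (insertAt≡take++drop k v xs)

insertAt-++ : ∀ xs v ys → insertAt (length xs) v (xs ++ ys) ≡ xs ++ v ∷ ys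
insertAt-++ [] v ys = refl
insertAt-++ (x ∷ xs) v ys = cong (x ∷_) (insertAt-++ xs v ys)

removeAt-++ : ∀ xs v ys → removeAt (length xs) (xs ++ v ∷ ys) ≡ xs ++ ys
removeAt-++ [] v ys = refl
removeAt-++ (x ∷ xs) v ys = cong (x ∷_) (removeAt-++ xs v ys)

removeAt-insertAt : ∀ k v xs → k ≤ length xs → removeAt k (insertAt k v xs) ≡ xs
removeAt-insertAt zero v xs _ = refl
removeAt-insertAt (suc k) v (x ∷ xs) (s≤s k≤) = cong (x ∷_) (removeAt-insertAt k v xs k≤)

length-insertAt : ∀ k v xs → length (insertAt k v xs) ≡ suc (length xs)
length-insertAt zero v xs = refl
length-insertAt (suc k) v [] = refl
length-insertAt (suc k) v (x ∷ xs) = cong suc (length-insertAt k v xs)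

↭-move : ∀ (v : ℕ) xs ys zs → xs ++ ys ++ v ∷ zs ↭ v ∷ xs ++ ys ++ zs
↭-move v xs ys zs = ↭-trans (++⁺ˡ xs (shift v ys zs)) (shift v xs (ys ++ zs))

insertAt-↭ : ∀ k v xs → insertAt k v xs ↭ v ∷ xs
insertAt-↭ zero v xs = ↭.refl
insertAt-↭ (suc k) v [] = ↭.refl
insertAt-↭ (suc k) v (x ∷ xs) = ↭-trans (↭.prep x (insertAt-↭ k v xs)) (↭.swap x v ↭.refl)

indexOf-++ : ∀ v xs ys → All (_< v) xs → indexOf v (xs ++ v ∷ ys) ≡ length xs
indexOf-++ v [] ys [] rewrite reflects-yes (≡ᵇ-reflects-≡ v v) refl = refl
indexOf-++ v (x ∷ xs) ys (x<v ∷ xs<v)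
  rewrite reflects-no (≡ᵇ-reflects-≡ x v) (<⇒≢ x<v) = cong suc (indexOf-++ v xs ys xs<v)

inv-insertAt-max : ∀ k v xs → k ≤ length xs → All (_< v) xs →
                   inv (insertAt k v xs) ≡ (length xs ∸ k) + inv xs
inv-insertAt-max k v xs k≤ xs<v = begin
  inv (insertAt k v xs)                              ≡⟨ cong inv (insertAt≡take++drop k v xs) ⟩
  inv (take k xs ++ v ∷ drop k xs)                   ≡⟨ inv-insert (take k xs) v (drop k xs) ⟩
  countGt v (take k xs) + countLess v (drop k xs) + inv (take k xs ++ drop k xs)
    ≡⟨ cong₂ (λ a b → a + b + inv (take k xs ++ drop k xs)) noneAbove allBelow ⟩
  (length xs ∸ k) + inv (take k xs ++ drop k xs)     ≡⟨ cong (λ ys → (length xs ∸ k) + inv ys) (take++drop≡id k xs) ⟩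
  (length xs ∸ k) + inv xs                           ∎
  where
  open ≡-Reasoning
  noneAbove : countGt v (take k xs) ≡ 0
  noneAbove = countGt-none v (All.map <⇒≤ (take⁺ k xs<v))
  allBelow : countLess v (drop k xs) ≡ length xs ∸ k
  allBelow = trans (countLess-all v (drop⁺ k xs<v)) (length-drop k xs)

memb-reflects-∈ : ∀ x ys → Reflects (x ∈ ys) (memb x ys)
memb-reflects-∈ x [] = ofⁿ λ ()
memb-reflects-∈ x (y ∷ ys) with (x ≤ᵇ y) ∧ (y ≤ᵇ x) | ≤ᵇ-reflects-≤ x y ×-reflects ≤ᵇ-reflects-≤ y x
... | true | ofʸ (x≤y , y≤x) = ofʸ (here (≤-antisym x≤y y≤x))
... | false | ofⁿ x≢y with memb x ys | memb-reflects-∈ x ys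
...   | true | ofʸ x∈ys = ofʸ (there x∈ys)
...   | false | ofⁿ x∉ys = ofⁿ λ { (here refl) → x≢y (≤-refl , ≤-refl) ; (there x∈ys) → x∉ys x∈ys }

removeMembers : List ℕ → List ℕ → List ℕ
removeMembers S [] = []
removeMembers S (x ∷ xs) = if memb x S then removeMembers S xs else x ∷ removeMembers S xs

list-induction : {P : List ℕ → Set} → P [] → (∀ x {xs} → P xs → P (x ∷ xs)) → ∀ xs → P xs
list-induction base step [] = base
list-induction base step (x ∷ xs) = step x (list-induction base step xs)

-- The filter inside complementIn is a local function that cannot be named, so the induction
-- motive is left for unification to find.
complementIn≡removeMembers : ∀ m S → complementIn m S ≡ removeMembers S (range m)
complementIn≡removeMembers m S with map suc (upTo m) | list-induction {_}
... | xs | induction = induction refl (λ x ih → cong-if (memb x S) ih) xs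
  where
  cong-if : ∀ b {x} {ys zs : List ℕ} → ys ≡ zs → (if b then ys else x ∷ ys) ≡ (if b then zs else x ∷ zs)
  cong-if b refl = refl

module _ {A B : Set} {f : A → B} where

  map⁺-injectiveOn : ∀ {xs} → (∀ {x y} → x ∈ xs → y ∈ xs → f x ≡ f y → x ≡ y) →
                     Unique xs → Unique (map f xs)
  map⁺-injectiveOn inj [] = []
  map⁺-injectiveOn inj (x≢xs ∷ u) =
    All-map⁺ (All.tabulate λ y∈ fx≡fy → All.lookup x≢xs y∈ (inj (here refl) (there y∈) fx≡fy))
    ∷ map⁺-injectiveOn (λ x∈ y∈ → inj (there x∈) (there y∈)) u

module _ {A : Set} (_≟ᴬ_ : DecidableEquality A) where

  open import Data.List.Membership.DecPropositional _≟ᴬ_ using (_∈?_)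

  private
    ∈-removeOne : ∀ {x y : A} ys zs → y ∈ ys ++ x ∷ zs → y ≢ x → y ∈ ys ++ zs
    ∈-removeOne ys zs y∈ y≢x with ∈-++⁻ ys y∈
    ... | inj₁ y∈ys = ∈-++⁺ˡ y∈ys
    ... | inj₂ (here y≡x) = ⊥-elim (y≢x y≡x)
    ... | inj₂ (there y∈zs) = ∈-++⁺ʳ ys y∈zs

    ⊆-removeOne : ∀ {x : A} {xs} ys zs → xs ⊆ ys ++ x ∷ zs → x ∉ xs → xs ⊆ ys ++ zs
    ⊆-removeOne ys zs sub x∉xs y∈xs = ∈-removeOne ys zs (sub y∈xs) λ { refl → x∉xs y∈xs }

    length-removeOne : ∀ (x : A) ys zs → length (ys ++ x ∷ zs) ≡ suc (length (ys ++ zs))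
    length-removeOne x ys zs = ↭-length (shift x ys zs)

  unique-⊆⇒length≤ : ∀ {xs ys : List A} → Unique xs → xs ⊆ ys → length xs ≤ length ys
  unique-⊆⇒length≤ [] _ = z≤n
  unique-⊆⇒length≤ {x ∷ xs} (x≢xs ∷ u) sub with ∈-∃++ (sub (here refl))
  ... | ys₁ , ys₂ , refl =
    ≤-trans (s≤s (unique-⊆⇒length≤ u (⊆-removeOne ys₁ ys₂ (sub ∘ there) (All¬⇒¬Any x≢xs))))
            (≤-reflexive (sym (length-removeOne x ys₁ ys₂)))

  unique-⊆-length≥⇒⊇ : ∀ {xs ys : List A} → Unique xs → xs ⊆ ys → length ys ≤ length xs → ys ⊆ xs
  unique-⊆-length≥⇒⊇ {xs} u sub len {y} y∈ys with y ∈? xs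
  ... | yes y∈xs = y∈xs
  ... | no y∉xs with ∈-∃++ y∈ys
  ...   | ys₁ , ys₂ , refl = ⊥-elim (<⇒≱ shorter len)
    where
    shorter : length xs < length (ys₁ ++ y ∷ ys₂)
    shorter = ≤-trans (s≤s (unique-⊆⇒length≤ u (⊆-removeOne ys₁ ys₂ sub y∉xs)))
                      (≤-reflexive (sym (length-removeOne y ys₁ ys₂)))

insertMax : ℕ → List ℕ × ℕ → List ℕ
insertMax m (v , k) = insertAt k m v

perms : ℕ → List (List ℕ)
perms zero = [ [] ]
perms (suc N) = map (insertMax (suc N)) (cartesianProduct (perms N) (upTo (suc N)))

perms-sound : ∀ N {w} → w ∈ perms N → w ↭ range N
perms-sound zero (here refl) = ↭.refl
perms-sound (suc N) w∈ with ∈-map⁻ (insertMax (suc N)) w∈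
... | (v , k) , vk∈ , refl = begin
  insertAt k (suc N) v     ↭⟨ insertAt-↭ k (suc N) v ⟩
  suc N ∷ v                ↭⟨ ↭.prep (suc N) (perms-sound N (proj₁ (∈-cartesianProduct⁻ (perms N) _ vk∈))) ⟩
  suc N ∷ range N          ↭⟨ range-suc N ⟨
  range (suc N)            ∎
  where open PermutationReasoning

perms-complete : ∀ N {w} → w ↭ range N → w ∈ perms N
perms-complete zero w↭ rewrite ↭-empty-inv w↭ = here refl
perms-complete (suc N) {w} w↭ with ∈-∃++ (∈-resp-↭ (↭-sym (↭-trans w↭ (range-suc N))) (here refl))
... | ys , zs , refl =
  subst (_∈ perms (suc N)) (insertAt-++ ys (suc N) zs)
        (∈-map⁺ (insertMax (suc N)) (∈-cartesianProduct⁺ (perms-complete N rest) (∈-upTo⁺ (s≤s ys≤N))))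
  where
  rest : ys ++ zs ↭ range N
  rest = drop-∷ (↭-trans (↭-sym (shift (suc N) ys zs)) (↭-trans w↭ (range-suc N)))
  ys≤N : length ys ≤ N
  ys≤N = subst (length ys ≤_) (perm-length rest) (subst (length ys ≤_) (sym (length-++ ys)) (m≤m+n _ _))

insertMax-injectiveOn : ∀ N {p q} → p ∈ cartesianProduct (perms N) (upTo (suc N)) →
                        q ∈ cartesianProduct (perms N) (upTo (suc N)) →
                        insertMax (suc N) p ≡ insertMax (suc N) q → p ≡ q
insertMax-injectiveOn N {v , k} {v′ , k′} p∈ q∈ eq = cong₂ _,_ v≡v′ k≡k′
  where
  position : ∀ {v k} → (v , k) ∈ cartesianProduct (perms N) (upTo (suc N)) →
             k ≤ length v × indexOf (suc N) (insertAt k (suc N) v) ≡ k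
  position {v} {k} vk∈ = k≤ , (begin
    indexOf (suc N) (insertAt k (suc N) v)                     ≡⟨ cong (indexOf (suc N)) (insertAt≡take++drop k (suc N) v) ⟩
    indexOf (suc N) (take k v ++ suc N ∷ drop k v)             ≡⟨ indexOf-++ (suc N) (take k v) (drop k v) (take⁺ k below) ⟩
    length (take k v)                                          ≡⟨ take-length v k≤ ⟩
    k                                                          ∎)
    where
    open ≡-Reasoning
    memberships : v ∈ perms N × k ∈ upTo (suc N)
    memberships = ∈-cartesianProduct⁻ (perms N) (upTo (suc N)) vk∈
    v↭ : v ↭ range N
    v↭ = perms-sound N (proj₁ memberships)
    k≤ : k ≤ length v
    k≤ = subst (k ≤_) (sym (perm-length v↭)) (s≤s⁻¹ (∈-upTo⁻ (proj₂ memberships)))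
    below : All (_< suc N) v
    below = All.map (s≤s ∘ proj₂) (perm-bounded v↭)
  k≡k′ : k ≡ k′
  k≡k′ = trans (sym (proj₂ (position p∈))) (trans (cong (indexOf (suc N)) eq) (proj₂ (position q∈)))
  v≡v′ : v ≡ v′
  v≡v′ = begin
    v                                    ≡⟨ removeAt-insertAt k (suc N) v (proj₁ (position p∈)) ⟨
    removeAt k (insertAt k (suc N) v)    ≡⟨ cong₂ removeAt k≡k′ eq ⟩
    removeAt k′ (insertAt k′ (suc N) v′) ≡⟨ removeAt-insertAt k′ (suc N) v′ (proj₁ (position q∈)) ⟩
    v′                                   ∎
    where open ≡-Reasoning

perms-unique : ∀ N → Unique (perms N)
perms-unique zero = [] ∷ []
perms-unique (suc N) =
  map⁺-injectiveOn (insertMax-injectiveOn N) (cartesianProduct⁺ (perms-unique N) (upTo⁺ (suc N)))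

injective⇒surjective : ∀ N (f : List ℕ → ℕ → List ℕ) →
  (∀ {σ c} → σ ↭ range N → c < suc N → f σ c ↭ range (suc N)) →
  (∀ {σ σ′ c c′} → σ ↭ range N → σ′ ↭ range N → c < suc N → c′ < suc N → f σ c ≡ f σ′ c′ → σ ≡ σ′ × c ≡ c′) →
  ∀ {π} → π ↭ range (suc N) → ∃₂ λ σ c → σ ↭ range N × c < suc N × f σ c ≡ π
injective⇒surjective N f f-↭ f-injective π↭ = preimage (covered (perms-complete (suc N) π↭))
  where
  domain : List (List ℕ × ℕ)
  domain = cartesianProduct (perms N) (upTo (suc N))
  valid : ∀ {σ c} → (σ , c) ∈ domain → σ ↭ range N × c < suc N
  valid σc∈ with ∈-cartesianProduct⁻ (perms N) (upTo (suc N)) σc∈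
  ... | σ∈ , c∈ = perms-sound N σ∈ , ∈-upTo⁻ c∈
  image-unique : Unique (map (uncurry f) domain)
  image-unique = map⁺-injectiveOn injective (cartesianProduct⁺ (perms-unique N) (upTo⁺ (suc N)))
    where
    injective : ∀ {p q} → p ∈ domain → q ∈ domain → uncurry f p ≡ uncurry f q → p ≡ q
    injective {σ , c} {σ′ , c′} p∈ q∈ eq
      with f-injective (proj₁ (valid p∈)) (proj₁ (valid q∈)) (proj₂ (valid p∈)) (proj₂ (valid q∈)) eq
    ... | refl , refl = refl
  image⊆perms : map (uncurry f) domain ⊆ perms (suc N)
  image⊆perms π∈ with ∈-map⁻ (uncurry f) π∈
  ... | (σ , c) , σc∈ , refl = perms-complete (suc N) (f-↭ (proj₁ (valid σc∈)) (proj₂ (valid σc∈)))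
  covered : perms (suc N) ⊆ map (uncurry f) domain
  covered = unique-⊆-length≥⇒⊇ (≡-dec _≟_) image-unique image⊆perms
              (≤-reflexive (trans (length-map (insertMax (suc N)) domain) (sym (length-map (uncurry f) domain))))
  preimage : ∀ {π} → π ∈ map (uncurry f) domain → ∃₂ λ σ c → σ ↭ range N × c < suc N × f σ c ≡ π
  preimage π∈ with ∈-map⁻ (uncurry f) π∈
  ... | (σ , c) , σc∈ , refl = σ , c , proj₁ (valid σc∈) , proj₂ (valid σc∈) , refl

trueCount : List Bool → ℕ
trueCount [] = 0
trueCount (true ∷ bs) = suc (trueCount bs)
trueCount (false ∷ bs) = trueCount bs

falseCount : List Bool → ℕ
falseCount [] = 0
falseCount (true ∷ bs) = falseCount bs
falseCount (false ∷ bs) = suc (falseCount bs)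

truePositions : ℕ → List Bool → List ℕ
truePositions i [] = []
truePositions i (true ∷ bs) = i ∷ truePositions (suc i) bs
truePositions i (false ∷ bs) = truePositions (suc i) bs

falsePositions : ℕ → List Bool → List ℕ
falsePositions i [] = []
falsePositions i (true ∷ bs) = falsePositions (suc i) bs
falsePositions i (false ∷ bs) = i ∷ falsePositions (suc i) bs

trueCount+falseCount : ∀ bs → trueCount bs + falseCount bs ≡ length bs
trueCount+falseCount [] = refl
trueCount+falseCount (true ∷ bs) = cong suc (trueCount+falseCount bs)
trueCount+falseCount (false ∷ bs) = trans (+-suc (trueCount bs) (falseCount bs)) (cong suc (trueCount+falseCount bs))

trueCount-++ : ∀ bs cs → trueCount (bs ++ cs) ≡ trueCount bs + trueCount cs
trueCount-++ [] cs = refl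
trueCount-++ (true ∷ bs) cs = cong suc (trueCount-++ bs cs)
trueCount-++ (false ∷ bs) cs = trueCount-++ bs cs

length-truePositions : ∀ i bs → length (truePositions i bs) ≡ trueCount bs
length-truePositions i [] = refl
length-truePositions i (true ∷ bs) = cong suc (length-truePositions (suc i) bs)
length-truePositions i (false ∷ bs) = length-truePositions (suc i) bs

truePositions-++false : ∀ i bs → truePositions i (bs ++ [ false ]) ≡ truePositions i bs
truePositions-++false i [] = refl
truePositions-++false i (true ∷ bs) = cong (i ∷_) (truePositions-++false (suc i) bs)
truePositions-++false i (false ∷ bs) = truePositions-++false (suc i) bs

truePositions-≥ : ∀ i bs → All (i ≤_) (truePositions i bs)
truePositions-≥ i [] = []
truePositions-≥ i (true ∷ bs) = ≤-refl ∷ All.map (≤-trans (n≤1+n i)) (truePositions-≥ (suc i) bs)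
truePositions-≥ i (false ∷ bs) = All.map (≤-trans (n≤1+n i)) (truePositions-≥ (suc i) bs)

truePosition : ℕ → ℕ → List Bool → ℕ
truePosition t i [] = i
truePosition t i (false ∷ bs) = truePosition t (suc i) bs
truePosition zero i (true ∷ bs) = i
truePosition (suc t) i (true ∷ bs) = truePosition t (suc i) bs

truePosition-≥ : ∀ t i bs → i ≤ truePosition t i bs
truePosition-≥ t i [] = ≤-refl
truePosition-≥ t i (false ∷ bs) = ≤-trans (n≤1+n i) (truePosition-≥ t (suc i) bs)
truePosition-≥ zero i (true ∷ bs) = ≤-refl
truePosition-≥ (suc t) i (true ∷ bs) = ≤-trans (n≤1+n i) (truePosition-≥ t (suc i) bs)

markFalse : ℕ → List Bool → List Bool
markFalse d [] = []
markFalse d (true ∷ bs) = true ∷ markFalse d bs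
markFalse zero (false ∷ bs) = true ∷ bs
markFalse (suc d) (false ∷ bs) = false ∷ markFalse d bs

truesBefore : ℕ → List Bool → ℕ
truesBefore d [] = 0
truesBefore d (true ∷ bs) = suc (truesBefore d bs)
truesBefore zero (false ∷ bs) = 0
truesBefore (suc d) (false ∷ bs) = truesBefore d bs

truesAfter : ℕ → List Bool → ℕ
truesAfter d [] = 0
truesAfter d (true ∷ bs) = truesAfter d bs
truesAfter zero (false ∷ bs) = trueCount bs
truesAfter (suc d) (false ∷ bs) = truesAfter d bs

falsePosition : ℕ → ℕ → List Bool → ℕ
falsePosition d i [] = i
falsePosition d i (true ∷ bs) = falsePosition d (suc i) bs
falsePosition zero i (false ∷ bs) = i
falsePosition (suc d) i (false ∷ bs) = falsePosition d (suc i) bs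

truesBefore+truesAfter : ∀ d bs → truesBefore d bs + truesAfter d bs ≡ trueCount bs
truesBefore+truesAfter d [] = refl
truesBefore+truesAfter d (true ∷ bs) = cong suc (truesBefore+truesAfter d bs)
truesBefore+truesAfter zero (false ∷ bs) = refl
truesBefore+truesAfter (suc d) (false ∷ bs) = truesBefore+truesAfter d bs

falsePosition≡ : ∀ d i bs → d < falseCount bs → falsePosition d i bs ≡ i + d + truesBefore d bs
falsePosition≡ d i (true ∷ bs) d< = trans (falsePosition≡ d (suc i) bs d<) (regroup i d (truesBefore d bs))
  where
  regroup : ∀ a b c → suc a + b + c ≡ a + b + suc c
  regroup = solve-∀
falsePosition≡ zero i (false ∷ bs) _ = sym (trans (+-identityʳ (i + 0)) (+-identityʳ i))
falsePosition≡ (suc d) i (false ∷ bs) (s≤s d<) =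
  trans (falsePosition≡ d (suc i) bs d<) (cong (_+ truesBefore d bs) (sym (+-suc i d)))

falsePosition-≥ : ∀ d i bs → i ≤ falsePosition d i bs
falsePosition-≥ d i [] = ≤-refl
falsePosition-≥ d i (true ∷ bs) = ≤-trans (n≤1+n i) (falsePosition-≥ d (suc i) bs)
falsePosition-≥ zero i (false ∷ bs) = ≤-refl
falsePosition-≥ (suc d) i (false ∷ bs) = ≤-trans (n≤1+n i) (falsePosition-≥ d (suc i) bs)

truePositions-markFalse : ∀ d i bs → d < falseCount bs →
  truePositions i (markFalse d bs) ↭ falsePosition d i bs ∷ truePositions i bs
truePositions-markFalse d i (true ∷ bs) d< =
  ↭-trans (↭.prep i (truePositions-markFalse d (suc i) bs d<)) (↭.swap i _ ↭.refl)
truePositions-markFalse zero i (false ∷ bs) _ = ↭.refl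
truePositions-markFalse (suc d) i (false ∷ bs) (s≤s d<) = truePositions-markFalse d (suc i) bs d<

nth-falsePositions : ∀ d i bs → d < falseCount bs → nth (falsePositions i bs) d ≡ just (falsePosition d i bs)
nth-falsePositions d i (true ∷ bs) d< = nth-falsePositions d (suc i) bs d<
nth-falsePositions zero i (false ∷ bs) _ = refl
nth-falsePositions (suc d) i (false ∷ bs) (s≤s d<) = nth-falsePositions d (suc i) bs d<

unmarkTrue : ℕ → List Bool → List Bool
unmarkTrue t [] = []
unmarkTrue t (false ∷ bs) = false ∷ unmarkTrue t bs
unmarkTrue zero (true ∷ bs) = false ∷ bs
unmarkTrue (suc t) (true ∷ bs) = true ∷ unmarkTrue t bs

falsesBefore : ℕ → List Bool → ℕ
falsesBefore t [] = 0
falsesBefore t (false ∷ bs) = suc (falsesBefore t bs)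
falsesBefore zero (true ∷ bs) = 0
falsesBefore (suc t) (true ∷ bs) = falsesBefore t bs

length-markFalse : ∀ d bs → length (markFalse d bs) ≡ length bs
length-markFalse d [] = refl
length-markFalse d (true ∷ bs) = cong suc (length-markFalse d bs)
length-markFalse zero (false ∷ bs) = refl
length-markFalse (suc d) (false ∷ bs) = cong suc (length-markFalse d bs)

unmarkTrue-markFalse : ∀ d bs → d < falseCount bs → unmarkTrue (truesBefore d bs) (markFalse d bs) ≡ bs
unmarkTrue-markFalse d (true ∷ bs) d< = cong (true ∷_) (unmarkTrue-markFalse d bs d<)
unmarkTrue-markFalse zero (false ∷ bs) _ = refl
unmarkTrue-markFalse (suc d) (false ∷ bs) (s≤s d<) = cong (false ∷_) (unmarkTrue-markFalse d bs d<)

falsesBefore-markFalse : ∀ d bs → d < falseCount bs → falsesBefore (truesBefore d bs) (markFalse d bs ++ [ false ]) ≡ d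
falsesBefore-markFalse d (true ∷ bs) d< = falsesBefore-markFalse d bs d<
falsesBefore-markFalse zero (false ∷ bs) _ = refl
falsesBefore-markFalse (suc d) (false ∷ bs) (s≤s d<) = cong suc (falsesBefore-markFalse d bs d<)

truePosition-markFalse : ∀ d i bs → d < falseCount bs →
  truePosition (truesBefore d bs) i (markFalse d bs ++ [ false ]) ≡ falsePosition d i bs
truePosition-markFalse d i (true ∷ bs) d< = truePosition-markFalse d (suc i) bs d<
truePosition-markFalse zero i (false ∷ bs) _ = refl
truePosition-markFalse (suc d) i (false ∷ bs) (s≤s d<) = truePosition-markFalse d (suc i) bs d<

truePosition-++false : ∀ t i bs → t < trueCount bs → truePosition t i (bs ++ [ false ]) ≡ truePosition t i bs
truePosition-++false t i (false ∷ bs) t< = truePosition-++false t (suc i) bs t<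
truePosition-++false zero i (true ∷ bs) _ = refl
truePosition-++false (suc t) i (true ∷ bs) (s≤s t<) = truePosition-++false t (suc i) bs t<

∉-truePositions : ∀ {i S} bs → All (_< i) S → i ∉ S ++ truePositions (suc i) bs
∉-truePositions {i} {S} bs S<i i∈ with ∈-++⁻ S i∈
... | inj₁ i∈S = <-irrefl refl (All.lookup S<i i∈S)
... | inj₂ i∈T = <-irrefl refl (All.lookup (truePositions-≥ (suc i) bs) i∈T)

removeMembers-truePositions : ∀ S i bs (f : ℕ → ℕ) → (∀ j → f j ≡ j + i) → All (_< i) S →
  removeMembers (S ++ truePositions i bs) (applyUpTo f (length bs)) ≡ falsePositions i bs
removeMembers-truePositions S i [] f f≗ S<i = refl
removeMembers-truePositions S i (true ∷ bs) f f≗ S<i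
  rewrite f≗ 0 | reflects-yes (memb-reflects-∈ i (S ++ i ∷ truePositions (suc i) bs)) (∈-++⁺ʳ S (here refl)) =
  trans (cong (λ T → removeMembers T (applyUpTo (f ∘ suc) (length bs))) (sym (++-assoc S [ i ] _)))
        (removeMembers-truePositions (S ++ [ i ]) (suc i) bs (f ∘ suc) (shift-≗ f≗)
           (++⁺ (All.map m<n⇒m<1+n S<i) (≤-refl ∷ [])))
  where
  shift-≗ : (∀ j → f j ≡ j + i) → ∀ j → f (suc j) ≡ j + suc i
  shift-≗ f≗ j = trans (f≗ (suc j)) (sym (+-suc j i))
removeMembers-truePositions S i (false ∷ bs) f f≗ S<i
  rewrite f≗ 0 | reflects-no (memb-reflects-∈ i (S ++ truePositions (suc i) bs)) (∉-truePositions bs S<i) =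
  cong (i ∷_) (removeMembers-truePositions S (suc i) bs (f ∘ suc) shift-≗ (All.map m<n⇒m<1+n S<i))
  where
  shift-≗ : ∀ j → f (suc j) ≡ j + suc i
  shift-≗ j = trans (f≗ (suc j)) (sym (+-suc j i))

complementIn-truePositions : ∀ N bs → length bs ≡ N → complementIn N (truePositions 1 bs) ≡ falsePositions 1 bs
complementIn-truePositions N bs refl = begin
  complementIn N (truePositions 1 bs)                              ≡⟨ complementIn≡removeMembers N _ ⟩
  removeMembers (truePositions 1 bs) (map suc (upTo N))            ≡⟨ cong (removeMembers _) (map-upTo suc N) ⟩
  removeMembers (truePositions 1 bs) (applyUpTo suc (length bs))   ≡⟨ removeMembers-truePositions [] 1 bs suc (λ j → +-comm 1 j) [] ⟩
  falsePositions 1 bs                                              ∎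
  where open ≡-Reasoning

module Decomposition (g h : ℕ) where

  IsExc : ℕ → ℕ → Set
  IsExc i x = i + g ≤ x × h ≤ x

  isExc-reflects : ∀ i x → Reflects (IsExc i x) (isExc g h i x)
  isExc-reflects i x = ≤ᵇ-reflects-≤ (i + g) x ×-reflects ≤ᵇ-reflects-≤ h x

  exc⇒IsExc : ∀ {i x} → isExc g h i x ≡ true → IsExc i x
  exc⇒IsExc {i} {x} = reflects-true (isExc-reflects i x)

  IsExc⇒exc : ∀ {i x} → i + g ≤ x → h ≤ x → isExc g h i x ≡ true
  IsExc⇒exc {i} {x} i+g≤x h≤x = reflects-yes (isExc-reflects i x) (i+g≤x , h≤x)

  small⇒nonExc : ∀ {i x} → x < i + g → isExc g h i x ≡ false
  small⇒nonExc {i} {x} x<i+g = reflects-no (isExc-reflects i x) (<⇒≱ x<i+g ∘ proj₁)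

  nonExc⇒small : ∀ {i x} → isExc g h i x ≡ false → h ≤ x → x < i + g
  nonExc⇒small {i} {x} nonExc h≤x = ≰⇒> λ i+g≤x → reflects-false (isExc-reflects i x) nonExc (i+g≤x , h≤x)

  exc-antitone : ∀ {i j x} → isExc g h i x ≡ true → j ≤ i → isExc g h j x ≡ true
  exc-antitone exc j≤i with exc⇒IsExc exc
  ... | i+g≤x , h≤x = IsExc⇒exc (≤-trans (+-monoˡ-≤ g j≤i) i+g≤x) h≤x

  nonExc-monotone : ∀ {i j x} → isExc g h i x ≡ false → i ≤ j → isExc g h j x ≡ false
  nonExc-monotone {i} {j} {x} nonExc i≤j with isExc g h j x in excʲ
  ... | false = refl
  ... | true with () ← trans (sym nonExc) (exc-antitone excʲ i≤j)

  excFlags : ℕ → List ℕ → List Bool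
  excFlags i [] = []
  excFlags i (x ∷ xs) = isExc g h i x ∷ excFlags (suc i) xs

  interleave : List Bool → List ℕ → List ℕ → List ℕ
  interleave [] X Y = []
  interleave (true ∷ bs) [] Y = []
  interleave (true ∷ bs) (x ∷ X) Y = x ∷ interleave bs X Y
  interleave (false ∷ bs) X [] = []
  interleave (false ∷ bs) X (y ∷ Y) = y ∷ interleave bs X Y

  FitsExc : ℕ → List Bool → List ℕ → Set
  FitsExc i [] [] = ⊤
  FitsExc i [] (_ ∷ _) = ⊥
  FitsExc i (true ∷ bs) [] = ⊥
  FitsExc i (true ∷ bs) (x ∷ X) = isExc g h i x ≡ true × FitsExc (suc i) bs X
  FitsExc i (false ∷ bs) X = FitsExc (suc i) bs X

  FitsNonExc : ℕ → List Bool → List ℕ → Set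
  FitsNonExc i [] [] = ⊤
  FitsNonExc i [] (_ ∷ _) = ⊥
  FitsNonExc i (false ∷ bs) [] = ⊥
  FitsNonExc i (false ∷ bs) (y ∷ Y) = isExc g h i y ≡ false × FitsNonExc (suc i) bs Y
  FitsNonExc i (true ∷ bs) Y = FitsNonExc (suc i) bs Y

  fitsExc-EXCL : ∀ i σ → FitsExc i (excFlags i σ) (EXCLFrom g h i σ)
  fitsExc-EXCL i [] = tt
  fitsExc-EXCL i (x ∷ σ) with isExc g h i x in exc
  ... | true = exc , fitsExc-EXCL (suc i) σ
  ... | false = fitsExc-EXCL (suc i) σ

  fitsNonExc-NEXCL : ∀ i σ → FitsNonExc i (excFlags i σ) (NEXCLFrom g h i σ)
  fitsNonExc-NEXCL i [] = tt
  fitsNonExc-NEXCL i (x ∷ σ) with isExc g h i x in exc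
  ... | true = fitsNonExc-NEXCL (suc i) σ
  ... | false = exc , fitsNonExc-NEXCL (suc i) σ

  interleave-EXCL-NEXCL : ∀ i σ → interleave (excFlags i σ) (EXCLFrom g h i σ) (NEXCLFrom g h i σ) ≡ σ
  interleave-EXCL-NEXCL i [] = refl
  interleave-EXCL-NEXCL i (x ∷ σ) with isExc g h i x
  ... | true = cong (x ∷_) (interleave-EXCL-NEXCL (suc i) σ)
  ... | false = cong (x ∷_) (interleave-EXCL-NEXCL (suc i) σ)

  exclpFrom≡truePositions : ∀ i σ → exclpFrom g h i σ ≡ truePositions i (excFlags i σ)
  exclpFrom≡truePositions i [] = refl
  exclpFrom≡truePositions i (x ∷ σ) with isExc g h i x
  ... | true = cong (i ∷_) (exclpFrom≡truePositions (suc i) σ)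
  ... | false = exclpFrom≡truePositions (suc i) σ

  length-excFlags : ∀ i σ → length (excFlags i σ) ≡ length σ
  length-excFlags i [] = refl
  length-excFlags i (x ∷ σ) = cong suc (length-excFlags (suc i) σ)

  FitsExc-length : ∀ i bs X → FitsExc i bs X → length X ≡ trueCount bs
  FitsExc-length i [] [] _ = refl
  FitsExc-length i (true ∷ bs) (x ∷ X) (_ , fits) = cong suc (FitsExc-length (suc i) bs X fits)
  FitsExc-length i (false ∷ bs) X fits = FitsExc-length (suc i) bs X fits

  FitsNonExc-length : ∀ i bs Y → FitsNonExc i bs Y → length Y ≡ falseCount bs
  FitsNonExc-length i [] [] _ = refl
  FitsNonExc-length i (false ∷ bs) (y ∷ Y) (_ , fits) = cong suc (FitsNonExc-length (suc i) bs Y fits)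
  FitsNonExc-length i (true ∷ bs) Y fits = FitsNonExc-length (suc i) bs Y fits

  Decomposes : ℕ → List ℕ → List Bool → List ℕ → List ℕ → Set
  Decomposes i π bs X Y = excFlags i π ≡ bs × EXCLFrom g h i π ≡ X × NEXCLFrom g h i π ≡ Y

  interleave-decomposes : ∀ i bs X Y → FitsExc i bs X → FitsNonExc i bs Y →
                          Decomposes i (interleave bs X Y) bs X Y
  interleave-decomposes i [] [] [] _ _ = refl , refl , refl
  interleave-decomposes i (true ∷ bs) (x ∷ X) Y (exc , fitsX) fitsY rewrite exc
    with interleave-decomposes (suc i) bs X Y fitsX fitsY
  ... | flags , EXCL , NEXCL = cong (true ∷_) flags , cong (x ∷_) EXCL , NEXCL
  interleave-decomposes i (false ∷ bs) X (y ∷ Y) fitsX (nonExc , fitsY) rewrite nonExc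
    with interleave-decomposes (suc i) bs X Y fitsX fitsY
  ... | flags , EXCL , NEXCL = cong (false ∷_) flags , EXCL , cong (y ∷_) NEXCL

  interleave-↭ : ∀ i bs X Y → FitsExc i bs X → FitsNonExc i bs Y → interleave bs X Y ↭ X ++ Y
  interleave-↭ i [] [] [] _ _ = ↭.refl
  interleave-↭ i (true ∷ bs) (x ∷ X) Y (_ , fitsX) fitsY = ↭.prep x (interleave-↭ (suc i) bs X Y fitsX fitsY)
  interleave-↭ i (false ∷ bs) X (y ∷ Y) fitsX (_ , fitsY) =
    ↭-trans (↭.prep y (interleave-↭ (suc i) bs X Y fitsX fitsY)) (↭-sym (shift y X Y))

  EXCLFrom-++ : ∀ i u w → EXCLFrom g h i (u ++ w) ≡ EXCLFrom g h i u ++ EXCLFrom g h (i + length u) w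
  EXCLFrom-++ i [] w rewrite +-identityʳ i = refl
  EXCLFrom-++ i (x ∷ u) w rewrite +-suc i (length u) with isExc g h i x
  ... | true = cong (x ∷_) (EXCLFrom-++ (suc i) u w)
  ... | false = EXCLFrom-++ (suc i) u w

  NEXCLFrom-++ : ∀ i u w → NEXCLFrom g h i (u ++ w) ≡ NEXCLFrom g h i u ++ NEXCLFrom g h (i + length u) w
  NEXCLFrom-++ i [] w rewrite +-identityʳ i = refl
  NEXCLFrom-++ i (x ∷ u) w rewrite +-suc i (length u) with isExc g h i x
  ... | true = NEXCLFrom-++ (suc i) u w
  ... | false = cong (x ∷_) (NEXCLFrom-++ (suc i) u w)

  exclpFrom-++ : ∀ i u w → exclpFrom g h i (u ++ w) ≡ exclpFrom g h i u ++ exclpFrom g h (i + length u) w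
  exclpFrom-++ i [] w rewrite +-identityʳ i = refl
  exclpFrom-++ i (x ∷ u) w rewrite +-suc i (length u) with isExc g h i x
  ... | true = cong (i ∷_) (exclpFrom-++ (suc i) u w)
  ... | false = exclpFrom-++ (suc i) u w

  small-letters-nonExc : ∀ i w → All (_< i + g) w →
    EXCLFrom g h i w ≡ [] × NEXCLFrom g h i w ≡ w × exclpFrom g h i w ≡ []
  small-letters-nonExc i [] [] = refl , refl , refl
  small-letters-nonExc i (x ∷ w) (x< ∷ w<) rewrite small⇒nonExc {i} {x} x<
    with small-letters-nonExc (suc i) w (All.map (λ y< → <-≤-trans y< (+-monoˡ-≤ g (n≤1+n i))) w<)
  ... | EXCL , NEXCL , exclp = EXCL , cong (x ∷_) NEXCL , exclp

  All-EXCLFrom : ∀ {P : ℕ → Set} i σ → All P σ → All P (EXCLFrom g h i σ)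
  All-EXCLFrom i [] [] = []
  All-EXCLFrom i (x ∷ σ) (px ∷ pσ) with isExc g h i x
  ... | true = px ∷ All-EXCLFrom (suc i) σ pσ
  ... | false = All-EXCLFrom (suc i) σ pσ

  All-NEXCLFrom : ∀ {P : ℕ → Set} i σ → All P σ → All P (NEXCLFrom g h i σ)
  All-NEXCLFrom i [] [] = []
  All-NEXCLFrom i (x ∷ σ) (px ∷ pσ) with isExc g h i x
  ... | true = All-NEXCLFrom (suc i) σ pσ
  ... | false = px ∷ All-NEXCLFrom (suc i) σ pσ

  FitsExc-++false : ∀ i bs X → FitsExc i bs X → FitsExc i (bs ++ [ false ]) X
  FitsExc-++false i [] [] _ = tt
  FitsExc-++false i (true ∷ bs) (x ∷ X) (exc , fits) = exc , FitsExc-++false (suc i) bs X fits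
  FitsExc-++false i (false ∷ bs) X fits = FitsExc-++false (suc i) bs X fits

  FitsNonExc-shift : ∀ i bs Y z → FitsNonExc i bs Y → isExc g h i z ≡ false →
                     FitsNonExc i (bs ++ [ false ]) (z ∷ Y)
  FitsNonExc-shift i [] [] z _ nonExc = nonExc , tt
  FitsNonExc-shift i (true ∷ bs) Y z fits nonExc =
    FitsNonExc-shift (suc i) bs Y z fits (nonExc-monotone nonExc (n≤1+n i))
  FitsNonExc-shift i (false ∷ bs) (y ∷ Y) z (nonExcʸ , fits) nonExc =
    nonExc , FitsNonExc-shift (suc i) bs Y y fits (nonExc-monotone nonExcʸ (n≤1+n i))

  small-suffix : ∀ i u w → All (_< i + length u + g) w →
    exclpFrom g h i (u ++ w) ≡ exclpFrom g h i u × EXCLFrom g h i (u ++ w) ≡ EXCLFrom g h i u ×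
    NEXCLFrom g h i (u ++ w) ≡ NEXCLFrom g h i u ++ w
  small-suffix i u w w< with small-letters-nonExc (i + length u) w w<
  ... | EXCL , NEXCL , exclp =
      trans (exclpFrom-++ i u w) (trans (cong (exclpFrom g h i u ++_) exclp) (++-identityʳ _))
    , trans (EXCLFrom-++ i u w) (trans (cong (EXCLFrom g h i u ++_) EXCL) (++-identityʳ _))
    , trans (NEXCLFrom-++ i u w) (cong (NEXCLFrom g h i u ++_) NEXCL)

  FitsExc-markFalse : ∀ i bs X d m → FitsExc i bs X → d < falseCount bs →
    isExc g h (falsePosition d i bs) m ≡ true →
    FitsExc i (markFalse d bs ++ [ false ]) (insertAt (truesBefore d bs) m X)
  FitsExc-markFalse i (true ∷ bs) (x ∷ X) d m (exc , fits) d< excᵐ =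
    exc , FitsExc-markFalse (suc i) bs X d m fits d< excᵐ
  FitsExc-markFalse i (false ∷ bs) X zero m fits _ excᵐ = excᵐ , FitsExc-++false (suc i) bs X fits
  FitsExc-markFalse i (false ∷ bs) X (suc d) m fits (s≤s d<) excᵐ =
    FitsExc-markFalse (suc i) bs X d m fits d< excᵐ

  FitsNonExc-markFalse : ∀ i bs Y d → FitsNonExc i bs Y → d < falseCount bs →
    FitsNonExc i (markFalse d bs ++ [ false ]) Y
  FitsNonExc-markFalse i (true ∷ bs) Y d fits d< = FitsNonExc-markFalse (suc i) bs Y d fits d<
  FitsNonExc-markFalse i (false ∷ bs) (y ∷ Y) zero (nonExc , fits) _ =
    FitsNonExc-shift (suc i) bs Y y fits (nonExc-monotone nonExc (n≤1+n i))
  FitsNonExc-markFalse i (false ∷ bs) (y ∷ Y) (suc d) (nonExc , fits) (s≤s d<) =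
    nonExc , FitsNonExc-markFalse (suc i) bs Y d fits d<

  FitsExc-≥ : ∀ i bs X → FitsExc i bs X → All (i + g ≤_) X
  FitsExc-≥ i [] [] _ = []
  FitsExc-≥ i (true ∷ bs) (x ∷ X) (exc , fits) =
    proj₁ (exc⇒IsExc exc) ∷ All.map (≤-trans (+-monoˡ-≤ g (n≤1+n i))) (FitsExc-≥ (suc i) bs X fits)
  FitsExc-≥ i (false ∷ bs) X fits = All.map (≤-trans (+-monoˡ-≤ g (n≤1+n i))) (FitsExc-≥ (suc i) bs X fits)

  excSlotCount : ℕ → ℕ → List Bool → ℕ
  excSlotCount y i [] = 0
  excSlotCount y i (true ∷ bs) = (if isExc g h i y then 1 else 0) + excSlotCount y (suc i) bs
  excSlotCount y i (false ∷ bs) = excSlotCount y (suc i) bs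

  excSlotCount-nonExc : ∀ y i bs → isExc g h i y ≡ false → excSlotCount y i bs ≡ 0
  excSlotCount-nonExc y i [] _ = refl
  excSlotCount-nonExc y i (true ∷ bs) nonExc rewrite nonExc =
    excSlotCount-nonExc y (suc i) bs (nonExc-monotone nonExc (n≤1+n i))
  excSlotCount-nonExc y i (false ∷ bs) nonExc = excSlotCount-nonExc y (suc i) bs (nonExc-monotone nonExc (n≤1+n i))

  excSlotCount≡trueCount-take : ∀ y → h ≤ y → ∀ k i bs → k + i + g ≡ suc y →
                                excSlotCount y i bs ≡ trueCount (take k bs)
  excSlotCount≡trueCount-take y h≤y zero i bs k+i+g≡ = excSlotCount-nonExc y i bs (small⇒nonExc (≤-reflexive (sym k+i+g≡)))
  excSlotCount≡trueCount-take y h≤y (suc k) i [] _ = refl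
  excSlotCount≡trueCount-take y h≤y (suc k) i (true ∷ bs) k+i+g≡
    rewrite IsExc⇒exc {i} {y} (≤-trans (m≤n+m (i + g) k) (≤-reflexive (trans (sym (+-assoc k i g)) (suc-injective k+i+g≡)))) h≤y =
    cong suc (excSlotCount≡trueCount-take y h≤y k (suc i) bs (trans (cong (_+ g) (+-suc k i)) k+i+g≡))
  excSlotCount≡trueCount-take y h≤y (suc k) i (false ∷ bs) k+i+g≡ =
    excSlotCount≡trueCount-take y h≤y k (suc i) bs (trans (cong (_+ g) (+-suc k i)) k+i+g≡)

  bump : ℕ → ℕ → List Bool → List ℕ → List ℕ
  bump z i [] X = []
  bump z i (false ∷ bs) X = bump z (suc i) bs X
  bump z i (true ∷ bs) [] = []
  bump z i (true ∷ bs) (x ∷ X) = if isExc g h i z then z ∷ bump x (suc i) bs X else x ∷ X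

  bumpedOut : ℕ → ℕ → List Bool → List ℕ → ℕ
  bumpedOut z i [] X = z
  bumpedOut z i (false ∷ bs) X = bumpedOut z (suc i) bs X
  bumpedOut z i (true ∷ bs) [] = z
  bumpedOut z i (true ∷ bs) (x ∷ X) = if isExc g h i z then bumpedOut x (suc i) bs X else z

  record Bump (z p i : ℕ) (bs : List Bool) (X : List ℕ) (y : ℕ) (X′ : List ℕ) : Set where
    field
      before after : List ℕ
      splits : z ∷ X ≡ before ++ y ∷ after
      result : X′ ≡ before ++ after
      after>y : All (y <_) after
      excSlots : excSlotCount y i bs ≡ length before
      exc : isExc g h p y ≡ true
      fits : FitsExc i bs X′

  bump-spec : ∀ z p i bs X → FitsExc i bs X → isExc g h p z ≡ true → p < i →
              Bump z p i bs X (bumpedOut z i bs X) (bump z i bs X)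
  bump-spec z p i [] [] _ excᶻ _ = record
    { before = [] ; after = [] ; splits = refl ; result = refl ; after>y = [] ; excSlots = refl ; exc = excᶻ ; fits = tt }
  bump-spec z p i (false ∷ bs) X fits excᶻ p<i = record { Bump r }
    where r = bump-spec z p (suc i) bs X fits excᶻ (m<n⇒m<1+n p<i)
  bump-spec z p i (true ∷ bs) (x ∷ X) (excˣ , fitsX) excᶻ p<i with isExc g h i z in excᶻⁱ
  ... | true = record
    { before = z ∷ before ; after = after ; splits = cong (z ∷_) splits ; result = cong (z ∷_) result ; after>y = after>y
    ; excSlots = trans (cong (λ b → (if b then 1 else 0) + excSlotCount (bumpedOut x (suc i) bs X) (suc i) bs) exc)
                       (cong suc excSlots)
    ; exc = exc-antitone exc (<⇒≤ p<i) ; fits = excᶻⁱ , fits }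
    where open Bump (bump-spec x i (suc i) bs X fitsX excˣ (n<1+n i))
  ... | false = record
    { before = [] ; after = x ∷ X ; splits = refl ; result = refl
    ; after>y = All.map (<-≤-trans z<i+g) (FitsExc-≥ i (true ∷ bs) (x ∷ X) (excˣ , fitsX))
    ; excSlots = trans (cong (λ b → (if b then 1 else 0) + excSlotCount z (suc i) bs) excᶻⁱ)
                       (excSlotCount-nonExc z (suc i) bs (nonExc-monotone excᶻⁱ (n≤1+n i)))
    ; exc = excᶻ ; fits = excˣ , fitsX }
    where
    z<i+g : z < i + g
    z<i+g = nonExc⇒small excᶻⁱ (proj₂ (exc⇒IsExc {p} excᶻ))

  insertExc : ℕ → ℕ → ℕ → List Bool → List ℕ → List ℕ
  insertExc m t i [] X = []
  insertExc m t i (false ∷ bs) X = insertExc m t (suc i) bs X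
  insertExc m t i (true ∷ bs) [] = []
  insertExc m zero i (true ∷ bs) (x ∷ X) = m ∷ bump x (suc i) bs X
  insertExc m (suc t) i (true ∷ bs) (x ∷ X) = x ∷ insertExc m t (suc i) bs X

  displaced : ℕ → ℕ → List Bool → List ℕ → ℕ
  displaced t i [] X = 0
  displaced t i (false ∷ bs) X = displaced t (suc i) bs X
  displaced t i (true ∷ bs) [] = 0
  displaced zero i (true ∷ bs) (x ∷ X) = bumpedOut x (suc i) bs X
  displaced (suc t) i (true ∷ bs) (x ∷ X) = displaced t (suc i) bs X

  record ExcInsertion (m t i : ℕ) (bs : List Bool) (X : List ℕ) (y : ℕ) (X′ : List ℕ) : Set where
    field
      kept shifted after : List ℕ
      splits : X ≡ kept ++ shifted ++ y ∷ after
      result : X′ ≡ kept ++ m ∷ shifted ++ after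
      length-kept : length kept ≡ t
      after>y : All (y <_) after
      excSlots : excSlotCount y i bs ≡ t + suc (length shifted)
      exc : isExc g h (truePosition t i bs) y ≡ true
      fits : FitsExc i bs X′

  insertExc-spec : ∀ m t i bs X → FitsExc i bs X → t < trueCount bs → h ≤ m → All (_< m) X →
                   ExcInsertion m t i bs X (displaced t i bs X) (insertExc m t i bs X)
  insertExc-spec m t i (false ∷ bs) X fitsX t< h≤m X<m = record { ExcInsertion r }
    where r = insertExc-spec m t (suc i) bs X fitsX t< h≤m X<m
  insertExc-spec m zero i (true ∷ bs) (x ∷ X) (excˣ , fitsX) _ h≤m (x<m ∷ _) = record
    { kept = [] ; shifted = before ; after = after ; splits = splits ; result = cong (m ∷_) result
    ; length-kept = refl ; after>y = after>y
    ; excSlots = trans (cong (λ b → (if b then 1 else 0) + excSlotCount (bumpedOut x (suc i) bs X) (suc i) bs) exc)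
                       (cong suc excSlots)
    ; exc = exc
    ; fits = IsExc⇒exc {i} (≤-trans (proj₁ (exc⇒IsExc {i} excˣ)) (<⇒≤ x<m)) h≤m , fits }
    where open Bump (bump-spec x i (suc i) bs X fitsX excˣ (n<1+n i))
  insertExc-spec m (suc t) i (true ∷ bs) (x ∷ X) (excˣ , fitsX) (s≤s t<) h≤m (_ ∷ X<m) = record
    { kept = x ∷ kept ; shifted = shifted ; after = after ; splits = cong (x ∷_) splits ; result = cong (x ∷_) result
    ; length-kept = cong suc length-kept ; after>y = after>y
    ; excSlots = trans (cong (λ b → (if b then 1 else 0) + excSlotCount (displaced t (suc i) bs X) (suc i) bs)
                             (exc-antitone exc (≤-trans (n≤1+n i) (truePosition-≥ t (suc i) bs))))
                       (cong suc excSlots)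
    ; exc = exc ; fits = excˣ , fits }
    where open ExcInsertion (insertExc-spec m t (suc i) bs X fitsX t< h≤m X<m)

  insertNonExc : ℕ → ℕ → List Bool → List ℕ → List ℕ
  insertNonExc y i [] Y = y ∷ Y
  insertNonExc y i (true ∷ bs) Y = insertNonExc y (suc i) bs Y
  insertNonExc y i (false ∷ bs) [] = [ y ]
  insertNonExc y i (false ∷ bs) (z ∷ Y) = if isExc g h i y then z ∷ insertNonExc y (suc i) bs Y else y ∷ z ∷ Y

  insertNonExc-here : ∀ y i bs Y → isExc g h i y ≡ false → insertNonExc y i (bs ++ [ false ]) Y ≡ y ∷ Y
  insertNonExc-here y i [] [] _ = refl
  insertNonExc-here y i [] (z ∷ Y) nonExc rewrite nonExc = refl
  insertNonExc-here y i (true ∷ bs) Y nonExc = insertNonExc-here y (suc i) bs Y (nonExc-monotone nonExc (n≤1+n i))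
  insertNonExc-here y i (false ∷ bs) [] _ = refl
  insertNonExc-here y i (false ∷ bs) (z ∷ Y) nonExc rewrite nonExc = refl

  private
    exc-before : ∀ {y k i} → h ≤ y → suc k + i + g ≡ suc y → isExc g h i y ≡ true
    exc-before {y} {k} {i} h≤y k+i+g≡ =
      IsExc⇒exc (≤-trans (m≤n+m (i + g) k) (≤-reflexive (trans (sym (+-assoc k i g)) (suc-injective k+i+g≡)))) h≤y

    shift-position : ∀ {k i y} → suc k + i + g ≡ suc y → k + suc i + g ≡ suc y
    shift-position {k} {i} k+i+g≡ = trans (cong (_+ g) (+-suc k i)) k+i+g≡

  insertNonExc≡ : ∀ y → h ≤ y → ∀ k i bs Y → FitsNonExc i bs Y → k + i + g ≡ suc y →
    insertNonExc y i (bs ++ [ false ]) Y ≡ take (falseCount (take k bs)) Y ++ y ∷ drop (falseCount (take k bs)) Y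
  insertNonExc≡ y h≤y zero i bs Y _ k+i+g≡ = insertNonExc-here y i bs Y (small⇒nonExc (≤-reflexive (sym k+i+g≡)))
  insertNonExc≡ y h≤y (suc k) i [] [] _ _ = refl
  insertNonExc≡ y h≤y (suc k) i (true ∷ bs) Y fits k+i+g≡ = insertNonExc≡ y h≤y k (suc i) bs Y fits (shift-position k+i+g≡)
  insertNonExc≡ y h≤y (suc k) i (false ∷ bs) (z ∷ Y) (_ , fits) k+i+g≡ rewrite exc-before {y} {k} {i} h≤y k+i+g≡ =
    cong (z ∷_) (insertNonExc≡ y h≤y k (suc i) bs Y fits (shift-position k+i+g≡))

  FitsNonExc-insertNonExc : ∀ y → h ≤ y → ∀ k i bs Y → FitsNonExc i bs Y → k ≤ length bs → k + i + g ≡ suc y →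
    FitsNonExc i (bs ++ [ false ]) (insertNonExc y i (bs ++ [ false ]) Y)
  FitsNonExc-insertNonExc y h≤y zero i bs Y fits _ k+i+g≡ =
    subst (FitsNonExc i (bs ++ [ false ])) (sym (insertNonExc-here y i bs Y nonExc)) (FitsNonExc-shift i bs Y y fits nonExc)
    where nonExc = small⇒nonExc {i} {y} (≤-reflexive (sym k+i+g≡))
  FitsNonExc-insertNonExc y h≤y (suc k) i (true ∷ bs) Y fits (s≤s k≤) k+i+g≡ =
    FitsNonExc-insertNonExc y h≤y k (suc i) bs Y fits k≤ (shift-position k+i+g≡)
  FitsNonExc-insertNonExc y h≤y (suc k) i (false ∷ bs) (z ∷ Y) (nonExcᶻ , fits) (s≤s k≤) k+i+g≡
    rewrite exc-before {y} {k} {i} h≤y k+i+g≡ =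
    nonExcᶻ , FitsNonExc-insertNonExc y h≤y k (suc i) bs Y fits k≤ (shift-position k+i+g≡)

  FitsNonExc-split : ∀ i bs cs Y → FitsNonExc i (bs ++ cs) Y →
    FitsNonExc i bs (take (falseCount bs) Y) × FitsNonExc (i + length bs) cs (drop (falseCount bs) Y)
  FitsNonExc-split i [] cs Y fits = tt , subst (λ k → FitsNonExc k cs Y) (sym (+-identityʳ i)) fits
  FitsNonExc-split i (true ∷ bs) cs Y fits with FitsNonExc-split (suc i) bs cs Y fits
  ... | fits₁ , fits₂ = fits₁ , subst (λ k → FitsNonExc k cs (drop (falseCount bs) Y)) (sym (+-suc i (length bs))) fits₂
  FitsNonExc-split i (false ∷ bs) cs (y ∷ Y) (nonExc , fits) with FitsNonExc-split (suc i) bs cs Y fits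
  ... | fits₁ , fits₂ = (nonExc , fits₁) , subst (λ k → FitsNonExc k cs (drop (falseCount bs) Y)) (sym (+-suc i (length bs))) fits₂

  FitsNonExc-below : ∀ i bs Y y → FitsNonExc i bs Y → h ≤ y → i + length bs + g ≤ suc y → All (_< y) Y
  FitsNonExc-below i [] [] y _ _ _ = []
  FitsNonExc-below i (true ∷ bs) Y y fits h≤y bound =
    FitsNonExc-below (suc i) bs Y y fits h≤y (subst (λ k → k + g ≤ suc y) (+-suc i (length bs)) bound)
  FitsNonExc-below i (false ∷ bs) (z ∷ Y) y (nonExc , fits) h≤y bound =
    z<y ∷ FitsNonExc-below (suc i) bs Y y fits h≤y bound′
    where
    bound′ : suc i + length bs + g ≤ suc y
    bound′ = subst (λ k → k + g ≤ suc y) (+-suc i (length bs)) bound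
    z<y : z < y
    z<y with z <? y
    ... | yes z<y = z<y
    ... | no z≮y = ⊥-elim (reflects-false (isExc-reflects i z) nonExc
                    (≤-trans i+g≤y (≮⇒≥ z≮y) , ≤-trans h≤y (≮⇒≥ z≮y)))
      where
      i+g≤y : i + g ≤ y
      i+g≤y = s≤s⁻¹ (≤-trans (s≤s (+-monoˡ-≤ g (m≤m+n i (length bs)))) bound′)

  hasCandidate : ℕ → ℕ → List Bool → List ℕ → Bool
  hasCandidate p i [] Y = false
  hasCandidate p i (true ∷ bs) Y = hasCandidate p (suc i) bs Y
  hasCandidate p i (false ∷ bs) [] = false
  hasCandidate p i (false ∷ bs) (z ∷ Y) = isExc g h p z ∨ hasCandidate (p ⊔ i) (suc i) bs Y

  lastCandidate : ℕ → ℕ → List Bool → List ℕ → ℕ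
  lastCandidate p i [] Y = 0
  lastCandidate p i (true ∷ bs) Y = lastCandidate p (suc i) bs Y
  lastCandidate p i (false ∷ bs) [] = 0
  lastCandidate p i (false ∷ bs) (z ∷ Y) =
    if hasCandidate (p ⊔ i) (suc i) bs Y then lastCandidate (p ⊔ i) (suc i) bs Y else z

  removeLastCandidate : ℕ → ℕ → List Bool → List ℕ → List ℕ
  removeLastCandidate p i [] Y = Y
  removeLastCandidate p i (true ∷ bs) Y = removeLastCandidate p (suc i) bs Y
  removeLastCandidate p i (false ∷ bs) [] = []
  removeLastCandidate p i (false ∷ bs) (z ∷ Y) =
    if hasCandidate (p ⊔ i) (suc i) bs Y then z ∷ removeLastCandidate (p ⊔ i) (suc i) bs Y else Y

  no-candidate : ∀ q i bs z Y → q < i → isExc g h q z ≡ false → FitsNonExc i bs Y →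
                 hasCandidate q i (bs ++ [ false ]) (z ∷ Y) ≡ false
  no-candidate q i [] z [] _ nonExc _ rewrite nonExc = refl
  no-candidate q i (true ∷ bs) z Y q<i nonExc fits = no-candidate q (suc i) bs z Y (m<n⇒m<1+n q<i) nonExc fits
  no-candidate q i (false ∷ bs) z (z′ ∷ Y) q<i nonExc (nonExc′ , fits) rewrite nonExc | m≤n⇒m⊔n≡n (<⇒≤ q<i) =
    no-candidate i (suc i) bs z′ Y (n<1+n i) nonExc′ fits

  exc-⊔ : ∀ {a b y} → isExc g h a y ≡ true → isExc g h b y ≡ true → isExc g h (a ⊔ b) y ≡ true
  exc-⊔ {a} {b} excᵃ excᵇ with ≤-total a b
  ... | inj₁ a≤b rewrite m≤n⇒m⊔n≡n a≤b = excᵇ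
  ... | inj₂ b≤a rewrite m≥n⇒m⊔n≡m b≤a = excᵃ

  exc-nonExc⇒< : ∀ {a b y} → isExc g h a y ≡ true → isExc g h b y ≡ false → a < b
  exc-nonExc⇒< {a} {b} excᵃ nonExcᵇ with a <? b
  ... | yes a<b = a<b
  ... | no a≮b with () ← trans (sym nonExcᵇ) (exc-antitone excᵃ (≮⇒≥ a≮b))

  record IsLastCandidate (p i : ℕ) (bs : List Bool) (Y Y′ : List ℕ) (y : ℕ) : Set where
    field
      found : hasCandidate p i bs Y′ ≡ true
      last : lastCandidate p i bs Y′ ≡ y
      removed : removeLastCandidate p i bs Y′ ≡ Y

  insertNonExc-lastCandidate : ∀ p i bs Y y → FitsNonExc i bs Y → isExc g h p y ≡ true →
    IsLastCandidate p i (bs ++ [ false ]) Y (insertNonExc y i (bs ++ [ false ]) Y) y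
  insertNonExc-lastCandidate p i [] [] y _ exc =
    record { found = cong (_∨ false) exc ; last = refl ; removed = refl }
  insertNonExc-lastCandidate p i (true ∷ bs) Y y fits exc =
    record { IsLastCandidate (insertNonExc-lastCandidate p (suc i) bs Y y fits exc) }
  insertNonExc-lastCandidate p i (false ∷ bs) (z ∷ Y) y (nonExcᶻ , fits) exc with isExc g h i y in excⁱ
  ... | true = record
    { found = trans (cong (isExc g h p z ∨_) found) (∨-zeroʳ _)
    ; last = trans (cong (λ b → if b then lastCandidate (p ⊔ i) (suc i) bs′ Y′ else z) found) last
    ; removed = trans (cong (λ b → if b then z ∷ removeLastCandidate (p ⊔ i) (suc i) bs′ Y′ else Y′) found) (cong (z ∷_) removed) }
    where
    bs′ : List Bool
    bs′ = bs ++ [ false ]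
    Y′ : List ℕ
    Y′ = insertNonExc y (suc i) bs′ Y
    open IsLastCandidate (insertNonExc-lastCandidate (p ⊔ i) (suc i) bs Y y fits (exc-⊔ {p} {i} exc excⁱ))
  ... | false = record
    { found = cong (_∨ hasCandidate (p ⊔ i) (suc i) (bs ++ [ false ]) (z ∷ Y)) exc
    ; last = cong (λ b → if b then lastCandidate (p ⊔ i) (suc i) (bs ++ [ false ]) (z ∷ Y) else y) none-later
    ; removed = cong (λ b → if b then y ∷ removeLastCandidate (p ⊔ i) (suc i) (bs ++ [ false ]) (z ∷ Y) else z ∷ Y) none-later }
    where
    none-later : hasCandidate (p ⊔ i) (suc i) (bs ++ [ false ]) (z ∷ Y) ≡ false
    none-later = trans (cong (λ q → hasCandidate q (suc i) (bs ++ [ false ]) (z ∷ Y)) (m≤n⇒m⊔n≡n (<⇒≤ (exc-nonExc⇒< {p} {i} exc excⁱ))))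
                       (no-candidate i (suc i) bs z Y (n<1+n i) nonExcᶻ fits)

  no-candidate-markFalse : ∀ d i bs Y → FitsNonExc i bs Y → d < falseCount bs →
                           hasCandidate (falsePosition d i bs) i (markFalse d bs ++ [ false ]) Y ≡ false
  no-candidate-markFalse d i (true ∷ bs) Y fits d< = no-candidate-markFalse d (suc i) bs Y fits d<
  no-candidate-markFalse zero i (false ∷ bs) (z ∷ Y) (nonExc , fits) _ = no-candidate i (suc i) bs z Y (n<1+n i) nonExc fits
  no-candidate-markFalse (suc d) i (false ∷ bs) (z ∷ Y) (nonExc , fits) (s≤s d<)
    rewrite nonExc-monotone {i} {falsePosition d (suc i) bs} {z} nonExc (<⇒≤ (falsePosition-≥ d (suc i) bs))
          | m≥n⇒m⊔n≡m (<⇒≤ (falsePosition-≥ d (suc i) bs)) =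
    no-candidate-markFalse d (suc i) bs Y fits d<

module Construction (g h N : ℕ) where

  open Decomposition g h

  n : ℕ
  n = suc N

  EXCL NEXCL : List ℕ → List ℕ
  EXCL = EXCLFrom g h 1
  NEXCL = NEXCLFrom g h 1

  exclpWeight : List ℕ → ℕ
  exclpWeight S = sum (map (λ i → i + g ∸ 1) S)

  record Decomposed (σ : List ℕ) : Set where
    field
      fitsX : FitsExc 1 (excFlags 1 σ) (EXCL σ)
      fitsY : FitsNonExc 1 (excFlags 1 σ) (NEXCL σ)
      length-flags : length (excFlags 1 σ) ≡ N
      exclp≡ : exclp g h σ ≡ truePositions 1 (excFlags 1 σ)
      length-exclp : length (exclp g h σ) ≡ trueCount (excFlags 1 σ)
      X<n : All (_< n) (EXCL σ)
      Y<n : All (_< n) (NEXCL σ)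
      XY↭ : EXCL σ ++ NEXCL σ ↭ range N

  decomposed : ∀ {σ} → σ ↭ range N → Decomposed σ
  decomposed {σ} σ↭ = record
    { fitsX = fitsExc-EXCL 1 σ
    ; fitsY = fitsNonExc-NEXCL 1 σ
    ; length-flags = trans (length-excFlags 1 σ) (perm-length σ↭)
    ; exclp≡ = exclpFrom≡truePositions 1 σ
    ; length-exclp = trans (cong length (exclpFrom≡truePositions 1 σ)) (length-truePositions 1 (excFlags 1 σ))
    ; X<n = All-EXCLFrom 1 σ σ<n
    ; Y<n = All-NEXCLFrom 1 σ σ<n
    ; XY↭ = ↭-trans (↭-sym (subst (_↭ EXCL σ ++ NEXCL σ) (interleave-EXCL-NEXCL 1 σ)
                     (interleave-↭ 1 _ _ _ (fitsExc-EXCL 1 σ) (fitsNonExc-NEXCL 1 σ)))) σ↭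
    }
    where
    σ<n : All (_< n) σ
    σ<n = All.map (s≤s ∘ proj₂) (perm-bounded σ↭)

  -- Case A (c < g): n is inserted with exactly c letters after it, so it is a non-excedance.
  -- Case B (c = g + k < e + g): n takes the excedance slot t = e − 1 − k (slots counted from 0);
  -- each letter of a later excedance slot is pushed on to the next one as long as it remains an
  -- excedance there, and the letter y that drops out is inserted among the non-excedance letters
  -- at the first non-excedance position after y − g.
  -- Case C (c = e + g + d): the (d+1)-th non-excedance position becomes an excedance holding n,
  -- and the non-excedance letters move one non-excedance position to the right.
  φA : List ℕ → ℕ → List ℕ
  φA σ c = insertAt (N ∸ c) n σ

  insertionSlot : List ℕ → ℕ → ℕ
  insertionSlot σ k = trueCount (excFlags 1 σ) ∸ 1 ∸ k

  displacedLetter : List ℕ → ℕ → ℕ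
  displacedLetter σ k = displaced (insertionSlot σ k) 1 (excFlags 1 σ) (EXCL σ)

  φB : List ℕ → ℕ → List ℕ
  φB σ k = interleave (excFlags 1 σ ++ [ false ]) (insertExc n (insertionSlot σ k) 1 (excFlags 1 σ) (EXCL σ))
                      (insertNonExc (displacedLetter σ k) 1 (excFlags 1 σ ++ [ false ]) (NEXCL σ))

  φC : List ℕ → ℕ → List ℕ
  φC σ d = interleave (markFalse d (excFlags 1 σ) ++ [ false ])
                      (insertAt (truesBefore d (excFlags 1 σ)) n (EXCL σ)) (NEXCL σ)

  φ : List ℕ → ℕ → List ℕ
  φ σ c = if c <ᵇ g then φA σ c
          else if c <ᵇ length (exclp g h σ) + g then φB σ (c ∸ g)
          else φC σ (c ∸ length (exclp g h σ) ∸ g)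

  positionOfMax : List ℕ → ℕ
  positionOfMax π = truePosition (indexOf n (EXCL π)) 1 (excFlags 1 π)

  ψB : List ℕ → List ℕ × ℕ
  ψB π = interleave (take N bs) (insertAt (trueCount (take (y ∸ g) bs) ∸ 1) y (removeAt t X))
                    (removeLastCandidate (positionOfMax π) 1 bs Y)
       , g + (length X ∸ 1 ∸ t)
    where
    bs : List Bool
    bs = excFlags 1 π
    X Y : List ℕ
    X = EXCL π
    Y = NEXCL π
    t y : ℕ
    t = indexOf n X
    y = lastCandidate (positionOfMax π) 1 bs Y

  ψC : List ℕ → List ℕ × ℕ
  ψC π = interleave (unmarkTrue t (take N bs)) (removeAt t X) (NEXCL π) , (length X ∸ 1) + g + falsesBefore t bs
    where
    bs : List Bool
    bs = excFlags 1 π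
    X : List ℕ
    X = EXCL π
    t : ℕ
    t = indexOf n X

  -- n is a non-excedance only in case A.  In case B the letter pushed out of the excedance word
  -- is the last non-excedance letter that would be an excedance at the previous non-excedance
  -- position or at the position of n, whichever is later; in case C there is no such letter.
  ψ : List ℕ → List ℕ × ℕ
  ψ π = if memb n (NEXCL π) then (removeAt (indexOf n π) π , N ∸ indexOf n π)
        else if hasCandidate (positionOfMax π) 1 (excFlags 1 π) (NEXCL π) then ψB π
        else ψC π

  φ-A : ∀ σ c → c < g → φ σ c ≡ φA σ c
  φ-A σ c c<g rewrite reflects-yes (<ᵇ-reflects-< c g) c<g = refl

  φ-B : ∀ σ c → g ≤ c → c < length (exclp g h σ) + g → φ σ c ≡ φB σ (c ∸ g)
  φ-B σ c g≤c c<e+g rewrite reflects-no (<ᵇ-reflects-< c g) (≤⇒≯ g≤c) | reflects-yes (<ᵇ-reflects-< c _) c<e+g = refl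

  φ-C : ∀ σ c → length (exclp g h σ) + g ≤ c → φ σ c ≡ φC σ (c ∸ length (exclp g h σ) ∸ g)
  φ-C σ c e+g≤c rewrite reflects-no (<ᵇ-reflects-< c g) (≤⇒≯ (≤-trans (m≤n+m g _) e+g≤c))
                      | reflects-no (<ᵇ-reflects-< c _) (≤⇒≯ e+g≤c) = refl

  ψ-A : ∀ π → n ∈ NEXCL π → ψ π ≡ (removeAt (indexOf n π) π , N ∸ indexOf n π)
  ψ-A π n∈ rewrite reflects-yes (memb-reflects-∈ n (NEXCL π)) n∈ = refl

  ψ-B : ∀ π → n ∉ NEXCL π → hasCandidate (positionOfMax π) 1 (excFlags 1 π) (NEXCL π) ≡ true → ψ π ≡ ψB π
  ψ-B π n∉ found rewrite reflects-no (memb-reflects-∈ n (NEXCL π)) n∉ | found = refl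

  ψ-C : ∀ π → n ∉ NEXCL π → hasCandidate (positionOfMax π) 1 (excFlags 1 π) (NEXCL π) ≡ false → ψ π ≡ ψC π
  ψ-C π n∉ none rewrite reflects-no (memb-reflects-∈ n (NEXCL π)) n∉ | none = refl

  module CaseA {σ c} (σ↭ : σ ↭ range N) (c<g : c < g) (c≤N : c ≤ N) where

    private
      u v : List ℕ
      u = take (N ∸ c) σ
      v = drop (N ∸ c) σ

      π≡ : φA σ c ≡ u ++ n ∷ v
      π≡ = insertAt≡take++drop (N ∸ c) n σ

      N∸c≤length : N ∸ c ≤ length σ
      N∸c≤length = subst (N ∸ c ≤_) (sym (perm-length σ↭)) (m∸n≤m N c)

      length-u : length u ≡ N ∸ c
      length-u = take-length σ N∸c≤length

      length-v : length v ≡ c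
      length-v = trans (length-drop (N ∸ c) σ) (trans (cong (_∸ (N ∸ c)) (perm-length σ↭)) (m∸[m∸n]≡n c≤N))

      σ<n : All (_< n) σ
      σ<n = All.map (s≤s ∘ proj₂) (perm-bounded σ↭)

      n<position+g : n < suc (length u) + g
      n<position+g = s≤s (begin
        suc N                 ≡⟨ cong suc (m∸n+n≡m c≤N) ⟨
        suc (N ∸ c + c)       ≡⟨ +-suc (N ∸ c) c ⟨
        N ∸ c + suc c         ≤⟨ +-monoʳ-≤ (N ∸ c) c<g ⟩
        N ∸ c + g             ≡⟨ cong (_+ g) length-u ⟨
        length u + g          ∎)
        where open ≤-Reasoning

      v-small : All (_< suc (length u) + g) v
      v-small = All.map (λ x<n → <-trans x<n n<position+g) (drop⁺ (N ∸ c) σ<n)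

      σ-split : exclp g h (u ++ v) ≡ exclp g h u × EXCL (u ++ v) ≡ EXCL u × NEXCL (u ++ v) ≡ NEXCL u ++ v
      σ-split = small-suffix 1 u v v-small

      π-split : exclp g h (u ++ n ∷ v) ≡ exclp g h u × EXCL (u ++ n ∷ v) ≡ EXCL u × NEXCL (u ++ n ∷ v) ≡ NEXCL u ++ n ∷ v
      π-split = small-suffix 1 u (n ∷ v) (n<position+g ∷ v-small)

      in-σ : ∀ {A : Set} (f : List ℕ → A) → f (u ++ v) ≡ f σ
      in-σ f = cong f (take++drop≡id (N ∸ c) σ)

      in-π : ∀ {A : Set} (f : List ℕ → A) → f (φA σ c) ≡ f (u ++ n ∷ v)
      in-π f = cong f π≡

    exclp-φA : exclp g h (φA σ c) ≡ exclp g h σ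
    exclp-φA = trans (in-π (exclp g h)) (trans (proj₁ π-split) (trans (sym (proj₁ σ-split)) (in-σ (exclp g h))))

    EXCL-φA : EXCL (φA σ c) ≡ EXCL σ
    EXCL-φA = trans (in-π EXCL) (trans (proj₁ (proj₂ π-split)) (trans (sym (proj₁ (proj₂ σ-split))) (in-σ EXCL)))

    NEXCL-φA : NEXCL (φA σ c) ≡ NEXCL u ++ n ∷ v
    NEXCL-φA = trans (in-π NEXCL) (proj₂ (proj₂ π-split))

    inv-NEXCL-φA : inv (NEXCL (φA σ c)) ≡ c + inv (NEXCL σ)
    inv-NEXCL-φA = begin
      inv (NEXCL (φA σ c))                                             ≡⟨ cong inv NEXCL-φA ⟩
      inv (NEXCL u ++ n ∷ v)                                           ≡⟨ inv-insert (NEXCL u) n v ⟩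
      countGt n (NEXCL u) + countLess n v + inv (NEXCL u ++ v)         ≡⟨ cong₂ (λ a b → a + b + inv (NEXCL u ++ v)) none-above all-below ⟩
      c + inv (NEXCL u ++ v)                                           ≡⟨ cong (λ L → c + inv L) (trans (sym (proj₂ (proj₂ σ-split))) (in-σ NEXCL)) ⟩
      c + inv (NEXCL σ)                                                ∎
      where
      open ≡-Reasoning
      none-above : countGt n (NEXCL u) ≡ 0
      none-above = countGt-none n (All-NEXCLFrom 1 u (All.map <⇒≤ (take⁺ (N ∸ c) σ<n)))
      all-below : countLess n v ≡ c
      all-below = trans (countLess-all n (drop⁺ (N ∸ c) σ<n)) length-v

    den-φA : den g h (φA σ c) ≡ den g h σ + c
    den-φA = begin
      exclpWeight (exclp g h (φA σ c)) + inv (EXCL (φA σ c)) + inv (NEXCL (φA σ c))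
        ≡⟨ cong₂ (λ S X → exclpWeight S + inv X + inv (NEXCL (φA σ c))) exclp-φA EXCL-φA ⟩
      exclpWeight (exclp g h σ) + inv (EXCL σ) + inv (NEXCL (φA σ c))
        ≡⟨ cong (exclpWeight (exclp g h σ) + inv (EXCL σ) +_) inv-NEXCL-φA ⟩
      exclpWeight (exclp g h σ) + inv (EXCL σ) + (c + inv (NEXCL σ))
        ≡⟨ regroup (exclpWeight (exclp g h σ) + inv (EXCL σ)) c (inv (NEXCL σ)) ⟩
      den g h σ + c ∎
      where
      open ≡-Reasoning
      regroup : ∀ a b c → a + (b + c) ≡ a + c + b
      regroup = solve-∀

    φA-↭ : φA σ c ↭ range n
    φA-↭ = begin
      insertAt (N ∸ c) n σ   ↭⟨ insertAt-↭ (N ∸ c) n σ ⟩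
      n ∷ σ                  ↭⟨ ↭.prep n σ↭ ⟩
      n ∷ range N            ↭⟨ range-suc N ⟨
      range n                ∎
      where open PermutationReasoning

    n∈NEXCL-φA : n ∈ NEXCL (φA σ c)
    n∈NEXCL-φA = subst (n ∈_) (sym NEXCL-φA) (∈-++⁺ʳ (NEXCL u) (here refl))

    indexOf-φA : indexOf n (φA σ c) ≡ N ∸ c
    indexOf-φA = trans (in-π (indexOf n)) (trans (indexOf-++ n u v (take⁺ (N ∸ c) σ<n)) length-u)

    ψ-φA : ψ (φA σ c) ≡ (σ , c)
    ψ-φA = trans (ψ-A (φA σ c) n∈NEXCL-φA)
      (cong₂ _,_ (trans (cong (λ k → removeAt k (φA σ c)) indexOf-φA) (removeAt-insertAt (N ∸ c) n σ N∸c≤length))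
                 (trans (cong (N ∸_) indexOf-φA) (m∸[m∸n]≡n c≤N)))

  module CaseB {σ c} (h≤n : h ≤ n) (σ↭ : σ ↭ range N) (g≤c : g ≤ c) (c<e+g : c < length (exclp g h σ) + g) where

    open Decomposed (decomposed σ↭)

    k : ℕ
    k = c ∸ g

    private
      bs : List Bool
      bs = excFlags 1 σ
      X Y : List ℕ
      X = EXCL σ
      Y = NEXCL σ
      t y : ℕ
      t = insertionSlot σ k
      y = displacedLetter σ k

      k<trueCount : k < trueCount bs
      k<trueCount = subst (k <_) length-exclp
        (+-cancelʳ-< g k (length (exclp g h σ)) (subst (_< length (exclp g h σ) + g) (sym (m∸n+n≡m g≤c)) c<e+g))

      t+1+k≡ : t + suc k ≡ trueCount bs
      t+1+k≡ = arith (trueCount bs) k<trueCount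
        where
        arith : ∀ m → k < m → m ∸ 1 ∸ k + suc k ≡ m
        arith (suc m) (s≤s k≤m) = trans (+-suc (m ∸ k) k) (cong suc (m∸n+n≡m k≤m))

      t<trueCount : t < trueCount bs
      t<trueCount = subst (t <_) t+1+k≡ (m<m+n t (s≤s z≤n))

    open ExcInsertion (insertExc-spec n t 1 bs X fitsX t<trueCount h≤n X<n)

    private
      X′ A : List ℕ
      X′ = insertExc n t 1 bs X
      A = kept ++ shifted

      X≡ : X ≡ A ++ y ∷ after
      X≡ = trans splits (sym (++-assoc kept shifted (y ∷ after)))

      y<n : y < n
      y<n = All.lookup X<n (subst (y ∈_) (sym X≡) (∈-++⁺ʳ A (here refl)))

      h≤y : h ≤ y
      h≤y = proj₂ (exc⇒IsExc {truePosition t 1 bs} exc)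

      g<y : g < y
      g<y = ≤-trans (+-monoˡ-≤ g (truePosition-≥ t 1 bs)) (proj₁ (exc⇒IsExc {truePosition t 1 bs} exc))

      T : ℕ
      T = y ∸ g

      T+g≡y : T + g ≡ y
      T+g≡y = m∸n+n≡m (<⇒≤ g<y)

      T+1+g≡1+y : T + 1 + g ≡ suc y
      T+1+g≡1+y = trans (cong (_+ g) (+-comm T 1)) (cong suc T+g≡y)

      T≤N : T ≤ N
      T≤N = ≤-trans (m≤m+n T g) (≤-trans (≤-reflexive T+g≡y) (s≤s⁻¹ y<n))

      T≤length : T ≤ length bs
      T≤length = subst (T ≤_) (sym length-flags) T≤N

      trueCount-take : trueCount (take T bs) ≡ t + suc (length shifted)
      trueCount-take = trans (sym (excSlotCount≡trueCount-take y h≤y T 1 bs T+1+g≡1+y)) excSlots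

      s : ℕ
      s = falseCount (take T bs)
      Y₁ Y₂ Y′ : List ℕ
      Y₁ = take s Y
      Y₂ = drop s Y
      Y′ = insertNonExc y 1 (bs ++ [ false ]) Y

      Y′≡ : Y′ ≡ Y₁ ++ y ∷ Y₂
      Y′≡ = insertNonExc≡ y h≤y T 1 bs Y fitsY T+1+g≡1+y

      fitsX′ : FitsExc 1 (bs ++ [ false ]) X′
      fitsX′ = FitsExc-++false 1 bs X′ fits

      fitsY′ : FitsNonExc 1 (bs ++ [ false ]) Y′
      fitsY′ = FitsNonExc-insertNonExc y h≤y T 1 bs Y fitsY T≤length T+1+g≡1+y

      π-decomposes : Decomposes 1 (φB σ k) (bs ++ [ false ]) X′ Y′
      π-decomposes = interleave-decomposes 1 (bs ++ [ false ]) X′ Y′ fitsX′ fitsY′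

      Y-split : FitsNonExc 1 (take T bs) Y₁ × FitsNonExc (1 + length (take T bs)) (drop T bs) Y₂
      Y-split = FitsNonExc-split 1 (take T bs) (drop T bs) Y (subst (λ bs″ → FitsNonExc 1 bs″ Y) (sym (take++drop≡id T bs)) fitsY)

      Y₁<y : All (_< y) Y₁
      Y₁<y = FitsNonExc-below 1 (take T bs) Y₁ y (proj₁ Y-split) h≤y
               (≤-reflexive (trans (cong (λ m → suc m + g) (take-length bs T≤length)) (cong suc T+g≡y)))

      length-X : length X ≡ t + suc (length shifted) + length after
      length-X = begin
        length X                                      ≡⟨ cong length splits ⟩
        length (kept ++ shifted ++ y ∷ after)         ≡⟨ length-++ kept ⟩
        length kept + length (shifted ++ y ∷ after)   ≡⟨ cong₂ _+_ length-kept (length-++ shifted) ⟩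
        t + (length shifted + suc (length after))     ≡⟨ regroup t (length shifted) (length after) ⟩
        t + suc (length shifted) + length after       ∎
        where
        open ≡-Reasoning
        regroup : ∀ a b c → a + (b + suc c) ≡ a + suc b + c
        regroup = solve-∀

      shifted+after≡k : length shifted + length after ≡ k
      shifted+after≡k = suc-injective (+-cancelˡ-≡ t _ _ (begin
        t + suc (length shifted + length after)       ≡⟨ solve-+suc t (length shifted) (length after) ⟩
        t + suc (length shifted) + length after       ≡⟨ length-X ⟨
        length X                                      ≡⟨ FitsExc-length 1 bs X fitsX ⟩
        trueCount bs                                  ≡⟨ t+1+k≡ ⟨
        t + suc k                                     ∎))
        where
        open ≡-Reasoning
        solve-+suc : ∀ a b c → a + suc (b + c) ≡ a + suc b + c
        solve-+suc = solve-∀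

      Y₂+after+T≡N : length Y₂ + length after + T ≡ N
      Y₂+after+T≡N = begin
        length Y₂ + length after + T                           ≡⟨ cong₂ (λ a b → a + b + T) (FitsNonExc-length _ (drop T bs) Y₂ (proj₂ Y-split)) after≡ ⟩
        falseCount (drop T bs) + trueCount (drop T bs) + T     ≡⟨ cong (_+ T) (trans (+-comm (falseCount (drop T bs)) (trueCount (drop T bs))) (trueCount+falseCount (drop T bs))) ⟩
        length (drop T bs) + T                                 ≡⟨ cong (_+ T) (trans (length-drop T bs) (cong (_∸ T) length-flags)) ⟩
        N ∸ T + T                                              ≡⟨ m∸n+n≡m T≤N ⟩
        N                                                      ∎
        where
        open ≡-Reasoning
        after≡ : length after ≡ trueCount (drop T bs)
        after≡ = +-cancelˡ-≡ (t + suc (length shifted)) _ _ (begin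
          t + suc (length shifted) + length after                 ≡⟨ length-X ⟨
          length X                                                ≡⟨ FitsExc-length 1 bs X fitsX ⟩
          trueCount bs                                            ≡⟨ cong trueCount (take++drop≡id T bs) ⟨
          trueCount (take T bs ++ drop T bs)                      ≡⟨ trueCount-++ (take T bs) (drop T bs) ⟩
          trueCount (take T bs) + trueCount (drop T bs)           ≡⟨ cong (_+ trueCount (drop T bs)) trueCount-take ⟩
          t + suc (length shifted) + trueCount (drop T bs)        ∎)

      letters↭ : A ++ y ∷ after ++ Y₁ ++ Y₂ ↭ range N
      letters↭ = subst (_↭ range N) (trans (cong₂ _++_ X≡ (sym (take++drop≡id s Y))) (++-assoc A (y ∷ after) (Y₁ ++ Y₂))) XY↭

      -- Counting the letters of [N] above y = T + g in two ways.
      count-identity : countLess y Y₂ ≡ g + countGt y A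
      count-identity = +-cancelʳ-≡ (countGt y Y₂ + length after + T) _ _ (begin
        countLess y Y₂ + (countGt y Y₂ + length after + T)       ≡⟨ regroup₁ (countLess y Y₂) (countGt y Y₂) (length after) T ⟩
        countLess y Y₂ + countGt y Y₂ + length after + T         ≡⟨ cong (λ m → m + length after + T) below ⟩
        length Y₂ + length after + T                             ≡⟨ Y₂+after+T≡N ⟩
        N                                                        ≡⟨ countGt-around A after Y₁ Y₂ letters↭ after>y Y₁<y ⟨
        countGt y A + length after + countGt y Y₂ + y            ≡⟨ cong (countGt y A + length after + countGt y Y₂ +_) T+g≡y ⟨
        countGt y A + length after + countGt y Y₂ + (T + g)      ≡⟨ regroup₂ (countGt y A) (length after) (countGt y Y₂) T g ⟩
        g + countGt y A + (countGt y Y₂ + length after + T)      ∎)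
        where
        open ≡-Reasoning
        regroup₁ : ∀ a b c d → a + (b + c + d) ≡ a + b + c + d
        regroup₁ = solve-∀
        regroup₂ : ∀ a b c d e → a + b + c + (d + e) ≡ e + a + (c + b + d)
        regroup₂ = solve-∀
        below : countLess y Y₂ + countGt y Y₂ ≡ length Y₂
        below = trans (sym (+-identityʳ _)) (trans (cong (countLess y Y₂ + countGt y Y₂ +_)
                  (sym (countEq-around A after Y₁ Y₂ letters↭ after>y Y₁<y))) (countLess+countGt+countEq y Y₂))

      inv-X′ : inv X′ ≡ k + inv (A ++ after)
      inv-X′ = begin
        inv X′                                                          ≡⟨ cong inv result ⟩
        inv (kept ++ n ∷ shifted ++ after)                              ≡⟨ inv-insert kept n (shifted ++ after) ⟩
        countGt n kept + countLess n (shifted ++ after) + inv (kept ++ shifted ++ after)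
          ≡⟨ cong₃ (λ a b c → a + b + c) (countGt-none n (All.map <⇒≤ kept<n)) (countLess-all n shifted++after<n) (cong inv (sym (++-assoc kept shifted after))) ⟩
        length (shifted ++ after) + inv (A ++ after)                    ≡⟨ cong (_+ inv (A ++ after)) (trans (length-++ shifted) shifted+after≡k) ⟩
        k + inv (A ++ after)                                            ∎
        where
        open ≡-Reasoning
        X-parts<n : All (_< n) (kept ++ shifted ++ y ∷ after)
        X-parts<n = subst (All (_< n)) splits X<n
        kept<n : All (_< n) kept
        kept<n = proj₁ (++⁻ kept X-parts<n)
        shifted++after<n : All (_< n) (shifted ++ after)
        shifted++after<n with ++⁻ shifted (proj₂ (++⁻ kept X-parts<n))
        ... | shifted<n , (_ ∷ after<n) = ++⁺ shifted<n after<n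

      inv-X : inv X ≡ countGt y A + inv (A ++ after)
      inv-X = begin
        inv X                                                   ≡⟨ cong inv X≡ ⟩
        inv (A ++ y ∷ after)                                    ≡⟨ inv-insert A y after ⟩
        countGt y A + countLess y after + inv (A ++ after)      ≡⟨ cong (λ m → countGt y A + m + inv (A ++ after)) (countLess-none y (All.map <⇒≤ after>y)) ⟩
        countGt y A + 0 + inv (A ++ after)                      ≡⟨ cong (_+ inv (A ++ after)) (+-identityʳ (countGt y A)) ⟩
        countGt y A + inv (A ++ after)                          ∎
        where open ≡-Reasoning

      inv-Y′ : inv Y′ ≡ countLess y Y₂ + inv Y
      inv-Y′ = begin
        inv Y′                                                  ≡⟨ cong inv Y′≡ ⟩
        inv (Y₁ ++ y ∷ Y₂)                                      ≡⟨ inv-insert Y₁ y Y₂ ⟩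
        countGt y Y₁ + countLess y Y₂ + inv (Y₁ ++ Y₂)          ≡⟨ cong₂ (λ a b → a + countLess y Y₂ + inv b) (countGt-none y (All.map <⇒≤ Y₁<y)) (take++drop≡id s Y) ⟩
        countLess y Y₂ + inv Y                                  ∎
        where open ≡-Reasoning

    exclp-φB : exclp g h (φB σ k) ≡ exclp g h σ
    exclp-φB = begin
      exclp g h (φB σ k)                          ≡⟨ exclpFrom≡truePositions 1 (φB σ k) ⟩
      truePositions 1 (excFlags 1 (φB σ k))       ≡⟨ cong (truePositions 1) (proj₁ π-decomposes) ⟩
      truePositions 1 (bs ++ [ false ])           ≡⟨ truePositions-++false 1 bs ⟩
      truePositions 1 bs                          ≡⟨ exclp≡ ⟨
      exclp g h σ                                 ∎
      where open ≡-Reasoning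

    den-φB : den g h (φB σ k) ≡ den g h σ + c
    den-φB = begin
      exclpWeight (exclp g h (φB σ k)) + inv (EXCL (φB σ k)) + inv (NEXCL (φB σ k))
        ≡⟨ cong₃ (λ a b c → exclpWeight a + inv b + inv c) exclp-φB (proj₁ (proj₂ π-decomposes)) (proj₂ (proj₂ π-decomposes)) ⟩
      W + inv X′ + inv Y′
        ≡⟨ cong₂ (λ a b → W + a + b) inv-X′ (trans inv-Y′ (cong (_+ inv Y) count-identity)) ⟩
      W + (k + inv (A ++ after)) + (g + countGt y A + inv Y)
        ≡⟨ regroup W k (inv (A ++ after)) g (countGt y A) (inv Y) ⟩
      W + (countGt y A + inv (A ++ after)) + inv Y + (k + g)
        ≡⟨ cong₂ (λ a b → W + a + inv Y + b) (sym inv-X) (m∸n+n≡m g≤c) ⟩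
      den g h σ + c ∎
      where
      open ≡-Reasoning
      W : ℕ
      W = exclpWeight (exclp g h σ)
      regroup : ∀ a b p q r u → a + (b + p) + (q + r + u) ≡ a + (r + p) + u + (b + q)
      regroup = solve-∀

    φB-↭ : φB σ k ↭ range n
    φB-↭ = begin
      φB σ k                                            ↭⟨ interleave-↭ 1 (bs ++ [ false ]) X′ Y′ fitsX′ fitsY′ ⟩
      X′ ++ Y′                                          ≡⟨ cong₂ _++_ result Y′≡ ⟩
      (kept ++ n ∷ shifted ++ after) ++ Y₁ ++ y ∷ Y₂    ≡⟨ ++-assoc kept (n ∷ shifted ++ after) _ ⟩
      kept ++ n ∷ (shifted ++ after) ++ Y₁ ++ y ∷ Y₂    ↭⟨ shift n kept _ ⟩
      n ∷ kept ++ (shifted ++ after) ++ Y₁ ++ y ∷ Y₂    ≡⟨ cong (n ∷_) reassoc ⟩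
      n ∷ A ++ (after ++ Y₁) ++ y ∷ Y₂                  ↭⟨ ↭.prep n (↭-move y A (after ++ Y₁) Y₂) ⟩
      n ∷ y ∷ A ++ (after ++ Y₁) ++ Y₂                  ≡⟨ cong (λ L → n ∷ y ∷ A ++ L) (++-assoc after Y₁ Y₂) ⟩
      n ∷ y ∷ A ++ after ++ Y₁ ++ Y₂                    ↭⟨ ↭.prep n (shift y A (after ++ Y₁ ++ Y₂)) ⟨
      n ∷ A ++ y ∷ after ++ Y₁ ++ Y₂                    ↭⟨ ↭.prep n letters↭ ⟩
      n ∷ range N                                       ↭⟨ range-suc N ⟨
      range n                                           ∎
      where
      open PermutationReasoning
      reassoc : kept ++ (shifted ++ after) ++ Y₁ ++ y ∷ Y₂ ≡ A ++ (after ++ Y₁) ++ y ∷ Y₂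
      reassoc = trans (cong (kept ++_) (trans (++-assoc shifted after _) (cong (shifted ++_) (sym (++-assoc after Y₁ (y ∷ Y₂))))))
                      (sym (++-assoc kept shifted _))

    private
      π : List ℕ
      π = φB σ k
      bs′ : List Bool
      bs′ = bs ++ [ false ]

      flags-π : excFlags 1 π ≡ bs′
      flags-π = proj₁ π-decomposes
      EXCL-π : EXCL π ≡ X′
      EXCL-π = proj₁ (proj₂ π-decomposes)
      NEXCL-π : NEXCL π ≡ Y′
      NEXCL-π = proj₂ (proj₂ π-decomposes)

      n∉NEXCL : n ∉ NEXCL π
      n∉NEXCL n∈ = <-irrefl refl (All.lookup Y′<n (subst (n ∈_) (trans NEXCL-π Y′≡) n∈))
        where
        Y′<n : All (_< n) (Y₁ ++ y ∷ Y₂)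
        Y′<n = ++⁺ (take⁺ s Y<n) (y<n ∷ drop⁺ s Y<n)

      indexOf-n : indexOf n (EXCL π) ≡ t
      indexOf-n = begin
        indexOf n (EXCL π)                          ≡⟨ cong (indexOf n) (trans EXCL-π result) ⟩
        indexOf n (kept ++ n ∷ shifted ++ after)    ≡⟨ indexOf-++ n kept (shifted ++ after) kept<n ⟩
        length kept                                 ≡⟨ length-kept ⟩
        t                                           ∎
        where
        open ≡-Reasoning
        kept<n : All (_< n) kept
        kept<n = proj₁ (++⁻ kept (subst (All (_< n)) splits X<n))

      position : positionOfMax π ≡ truePosition t 1 bs
      position = trans (cong₂ (λ t′ bs″ → truePosition t′ 1 bs″) indexOf-n flags-π) (truePosition-++false t 1 bs t<trueCount)

      open IsLastCandidate (insertNonExc-lastCandidate (truePosition t 1 bs) 1 bs Y y fitsY exc)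

      search : ∀ {A : Set} (f : ℕ → List Bool → List ℕ → A) →
               f (positionOfMax π) (excFlags 1 π) (NEXCL π) ≡ f (truePosition t 1 bs) bs′ Y′
      search f = cong₃ f position flags-π NEXCL-π

      found′ : hasCandidate (positionOfMax π) 1 (excFlags 1 π) (NEXCL π) ≡ true
      found′ = trans (search (λ p b Z → hasCandidate p 1 b Z)) found

      ŷ : ℕ
      ŷ = lastCandidate (positionOfMax π) 1 (excFlags 1 π) (NEXCL π)

      ŷ≡y : ŷ ≡ y
      ŷ≡y = trans (search (λ p b Z → lastCandidate p 1 b Z)) last

      take-N : take N (excFlags 1 π) ≡ bs
      take-N = trans (cong (take N) flags-π)
                     (trans (cong (λ m → take m bs′) (sym length-flags)) (take-length-++ bs [ false ]))

      slot-y : trueCount (take (y ∸ g) (excFlags 1 π)) ∸ 1 ≡ length A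
      slot-y = begin
        trueCount (take T (excFlags 1 π)) ∸ 1         ≡⟨ cong (λ b → trueCount (take T b) ∸ 1) flags-π ⟩
        trueCount (take T bs′) ∸ 1                    ≡⟨ cong (λ b → trueCount b ∸ 1) (take-++ˡ T bs [ false ] T≤length) ⟩
        trueCount (take T bs) ∸ 1                     ≡⟨ cong (_∸ 1) trueCount-take ⟩
        t + suc (length shifted) ∸ 1                  ≡⟨ cong (_∸ 1) (+-suc t (length shifted)) ⟩
        t + length shifted                            ≡⟨ cong (_+ length shifted) length-kept ⟨
        length kept + length shifted                  ≡⟨ length-++ kept ⟨
        length A                                      ∎
        where open ≡-Reasoning

      X-recovered : insertAt (trueCount (take (ŷ ∸ g) (excFlags 1 π)) ∸ 1) ŷ (removeAt (indexOf n (EXCL π)) (EXCL π)) ≡ X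
      X-recovered = begin
        insertAt (trueCount (take (ŷ ∸ g) (excFlags 1 π)) ∸ 1) ŷ (removeAt (indexOf n (EXCL π)) (EXCL π))
          ≡⟨ cong (λ z → insertAt (trueCount (take (z ∸ g) (excFlags 1 π)) ∸ 1) z (removeAt (indexOf n (EXCL π)) (EXCL π))) ŷ≡y ⟩
        insertAt (trueCount (take T (excFlags 1 π)) ∸ 1) y (removeAt (indexOf n (EXCL π)) (EXCL π))
          ≡⟨ cong₂ (λ i L → insertAt i y (removeAt (indexOf n (EXCL π)) L)) slot-y (trans EXCL-π result) ⟩
        insertAt (length A) y (removeAt (indexOf n (EXCL π)) (kept ++ n ∷ shifted ++ after))
          ≡⟨ cong (λ i → insertAt (length A) y (removeAt i (kept ++ n ∷ shifted ++ after))) (trans indexOf-n (sym length-kept)) ⟩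
        insertAt (length A) y (removeAt (length kept) (kept ++ n ∷ shifted ++ after))
          ≡⟨ cong (insertAt (length A) y) (trans (removeAt-++ kept n (shifted ++ after)) (sym (++-assoc kept shifted after))) ⟩
        insertAt (length A) y (A ++ after)
          ≡⟨ insertAt-++ A y after ⟩
        A ++ y ∷ after
          ≡⟨ X≡ ⟨
        X ∎
        where open ≡-Reasoning

      σ-recovered : proj₁ (ψB π) ≡ σ
      σ-recovered = begin
        interleave (take N (excFlags 1 π))
                   (insertAt (trueCount (take (ŷ ∸ g) (excFlags 1 π)) ∸ 1) ŷ (removeAt (indexOf n (EXCL π)) (EXCL π)))
                   (removeLastCandidate (positionOfMax π) 1 (excFlags 1 π) (NEXCL π))
          ≡⟨ cong₃ interleave take-N X-recovered (trans (search (λ p b Z → removeLastCandidate p 1 b Z)) removed) ⟩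
        interleave bs X Y
          ≡⟨ interleave-EXCL-NEXCL 1 σ ⟩
        σ ∎
        where open ≡-Reasoning

      c-recovered : proj₂ (ψB π) ≡ c
      c-recovered = begin
        g + (length (EXCL π) ∸ 1 ∸ indexOf n (EXCL π))   ≡⟨ cong₂ (λ L i → g + (L ∸ 1 ∸ i)) length-EXCL indexOf-n ⟩
        g + (t + suc k ∸ 1 ∸ t)                          ≡⟨ cong (λ m → g + (m ∸ 1 ∸ t)) (+-suc t k) ⟩
        g + (t + k ∸ t)                                  ≡⟨ cong (g +_) (m+n∸m≡n t k) ⟩
        g + k                                            ≡⟨ m+[n∸m]≡n g≤c ⟩
        c                                                ∎
        where
        open ≡-Reasoning
        length-EXCL : length (EXCL π) ≡ t + suc k
        length-EXCL = trans (cong length EXCL-π) (trans (FitsExc-length 1 bs X′ fits) (sym t+1+k≡))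

    ψ-φB : ψ (φB σ k) ≡ (σ , c)
    ψ-φB = trans (ψ-B π n∉NEXCL found′) (cong₂ _,_ σ-recovered c-recovered)

  module CaseC {σ c} (1≤g : 1 ≤ g) (h≤n : h ≤ n) (σ↭ : σ ↭ range N) (c<n : c < n)
               (e+g≤c : length (exclp g h σ) + g ≤ c) where

    open Decomposed (decomposed σ↭)

    e d : ℕ
    e = length (exclp g h σ)
    d = c ∸ e ∸ g

    private
      bs : List Bool
      bs = excFlags 1 σ
      X Y : List ℕ
      X = EXCL σ
      Y = NEXCL σ
      p slot : ℕ
      p = falsePosition d 1 bs
      slot = truesBefore d bs

      d+e+g≡c : d + e + g ≡ c
      d+e+g≡c = trans (+-assoc d e g) (trans (cong (_+ (e + g)) (∸-+-assoc c e g)) (m∸n+n≡m e+g≤c))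

      d<falseCount : d < falseCount bs
      d<falseCount = +-cancelˡ-< e d (falseCount bs) (begin-strict
        e + d              ≡⟨ +-comm e d ⟩
        d + e              <⟨ m<m+n (d + e) 1≤g ⟩
        d + e + g          ≡⟨ d+e+g≡c ⟩
        c                  ≤⟨ s≤s⁻¹ c<n ⟩
        N                  ≡⟨ trans (trueCount+falseCount bs) length-flags ⟨
        trueCount bs + falseCount bs ≡⟨ cong (_+ falseCount bs) length-exclp ⟨
        e + falseCount bs  ∎)
        where open ≤-Reasoning

      p≡ : p ≡ suc (d + slot)
      p≡ = falsePosition≡ d 1 bs d<falseCount

      slot≤e : slot ≤ e
      slot≤e = subst (slot ≤_) (trans (truesBefore+truesAfter d bs) (sym length-exclp)) (m≤m+n slot _)

      n-exc : isExc g h p n ≡ true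
      n-exc = IsExc⇒exc (begin
        p + g              ≡⟨ cong (_+ g) p≡ ⟩
        suc (d + slot + g) ≤⟨ s≤s (+-monoˡ-≤ g (+-monoʳ-≤ d slot≤e)) ⟩
        suc (d + e + g)    ≡⟨ cong suc d+e+g≡c ⟩
        suc c              ≤⟨ c<n ⟩
        n                  ∎) h≤n
        where open ≤-Reasoning

      bs′ : List Bool
      bs′ = markFalse d bs ++ [ false ]
      X′ : List ℕ
      X′ = insertAt slot n X

      π-decomposes : Decomposes 1 (φC σ d) bs′ X′ Y
      π-decomposes = interleave-decomposes 1 bs′ X′ Y
        (FitsExc-markFalse 1 bs X d n fitsX d<falseCount n-exc) (FitsNonExc-markFalse 1 bs Y d fitsY d<falseCount)

      slot≤length : slot ≤ length X
      slot≤length = subst (slot ≤_) (sym (trans (FitsExc-length 1 bs X fitsX) (sym length-exclp))) slot≤e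

    exclp-φC : exclp g h (φC σ d) ↭ p ∷ exclp g h σ
    exclp-φC = begin
      exclp g h (φC σ d)                          ≡⟨ exclpFrom≡truePositions 1 (φC σ d) ⟩
      truePositions 1 (excFlags 1 (φC σ d))       ≡⟨ cong (truePositions 1) (proj₁ π-decomposes) ⟩
      truePositions 1 bs′                         ≡⟨ truePositions-++false 1 (markFalse d bs) ⟩
      truePositions 1 (markFalse d bs)            ↭⟨ truePositions-markFalse d 1 bs d<falseCount ⟩
      p ∷ truePositions 1 bs                      ≡⟨ cong (p ∷_) exclp≡ ⟨
      p ∷ exclp g h σ                             ∎
      where open PermutationReasoning

    dthSmallestNotIn-exclp : dthSmallestNotIn N (exclp g h σ) (d + 1) ≡ just p
    dthSmallestNotIn-exclp = begin
      nth (complementIn N (exclp g h σ)) (d + 1 ∸ 1)       ≡⟨ cong₂ (λ S k → nth (complementIn N S) k) exclp≡ (m+n∸n≡m d 1) ⟩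
      nth (complementIn N (truePositions 1 bs)) d          ≡⟨ cong (λ S → nth S d) (complementIn-truePositions N bs length-flags) ⟩
      nth (falsePositions 1 bs) d                          ≡⟨ nth-falsePositions d 1 bs d<falseCount ⟩
      just p                                               ∎
      where open ≡-Reasoning

    den-φC : den g h (φC σ d) ≡ den g h σ + c
    den-φC = begin
      exclpWeight (exclp g h (φC σ d)) + inv (EXCL (φC σ d)) + inv (NEXCL (φC σ d))
        ≡⟨ cong₃ (λ a b c → a + b + c) weight-φC (cong inv (proj₁ (proj₂ π-decomposes))) (cong inv (proj₂ (proj₂ π-decomposes))) ⟩
      (d + slot + g) + W + inv X′ + inv Y
        ≡⟨ cong (λ k → (d + slot + g) + W + k + inv Y) inv-X′ ⟩
      (d + slot + g) + W + (truesAfter d bs + inv X) + inv Y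
        ≡⟨ regroup d slot g W (truesAfter d bs) (inv X) (inv Y) ⟩
      W + inv X + inv Y + (d + (slot + truesAfter d bs) + g)
        ≡⟨ cong (λ k → W + inv X + inv Y + (d + k + g)) (trans (truesBefore+truesAfter d bs) (sym length-exclp)) ⟩
      den g h σ + (d + e + g)
        ≡⟨ cong (den g h σ +_) d+e+g≡c ⟩
      den g h σ + c ∎
      where
      open ≡-Reasoning
      W : ℕ
      W = exclpWeight (exclp g h σ)
      weight-φC : exclpWeight (exclp g h (φC σ d)) ≡ (d + slot + g) + W
      weight-φC = begin
        exclpWeight (exclp g h (φC σ d))                 ≡⟨ sum-↭ (map⁺ (λ i → i + g ∸ 1) exclp-φC) ⟩
        exclpWeight (p ∷ exclp g h σ)                   ≡⟨ cong (λ q → q + g ∸ 1 + W) p≡ ⟩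
        (d + slot + g) + W                              ∎
      inv-X′ : inv X′ ≡ truesAfter d bs + inv X
      inv-X′ = begin
        inv X′                                         ≡⟨ inv-insertAt-max slot n X slot≤length X<n ⟩
        length X ∸ slot + inv X                        ≡⟨ cong (λ k → k ∸ slot + inv X) (FitsExc-length 1 bs X fitsX) ⟩
        trueCount bs ∸ slot + inv X                    ≡⟨ cong (λ k → k ∸ slot + inv X) (truesBefore+truesAfter d bs) ⟨
        slot + truesAfter d bs ∸ slot + inv X          ≡⟨ cong (_+ inv X) (m+n∸m≡n slot (truesAfter d bs)) ⟩
        truesAfter d bs + inv X                        ∎
      regroup : ∀ d s g w a x y → (d + s + g) + w + (a + x) + y ≡ w + x + y + (d + (s + a) + g)
      regroup = solve-∀

    φC-↭ : φC σ d ↭ range n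
    φC-↭ = begin
      φC σ d              ↭⟨ interleave-↭ 1 bs′ X′ Y (FitsExc-markFalse 1 bs X d n fitsX d<falseCount n-exc) (FitsNonExc-markFalse 1 bs Y d fitsY d<falseCount) ⟩
      X′ ++ Y             ↭⟨ ++⁺ʳ Y (insertAt-↭ slot n X) ⟩
      n ∷ X ++ Y          ↭⟨ ↭.prep n XY↭ ⟩
      n ∷ range N         ↭⟨ range-suc N ⟨
      range n             ∎
      where open PermutationReasoning

    private
      flags-π : excFlags 1 (φC σ d) ≡ bs′
      flags-π = proj₁ π-decomposes

      EXCL-π : EXCL (φC σ d) ≡ X′
      EXCL-π = proj₁ (proj₂ π-decomposes)

      n∉NEXCL : n ∉ NEXCL (φC σ d)
      n∉NEXCL n∈ = <-irrefl refl (All.lookup Y<n (subst (n ∈_) (proj₂ (proj₂ π-decomposes)) n∈))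
      indexOf-n : indexOf n (EXCL (φC σ d)) ≡ slot
      indexOf-n = begin
        indexOf n (EXCL (φC σ d))                        ≡⟨ cong (indexOf n) (trans EXCL-π (insertAt≡take++drop slot n X)) ⟩
        indexOf n (take slot X ++ n ∷ drop slot X)       ≡⟨ indexOf-++ n (take slot X) (drop slot X) (take⁺ slot X<n) ⟩
        length (take slot X)                             ≡⟨ take-length X slot≤length ⟩
        slot                                             ∎
        where open ≡-Reasoning
      no-candidate-φC : hasCandidate (positionOfMax (φC σ d)) 1 (excFlags 1 (φC σ d)) (NEXCL (φC σ d)) ≡ false
      no-candidate-φC = begin
        hasCandidate (positionOfMax (φC σ d)) 1 (excFlags 1 (φC σ d)) (NEXCL (φC σ d))
          ≡⟨ cong₂ (λ t bs″ → hasCandidate (truePosition t 1 bs″) 1 bs″ (NEXCL (φC σ d))) indexOf-n flags-π ⟩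
        hasCandidate (truePosition slot 1 bs′) 1 bs′ (NEXCL (φC σ d))
          ≡⟨ cong₂ (λ q Y′ → hasCandidate q 1 bs′ Y′) (truePosition-markFalse d 1 bs d<falseCount) (proj₂ (proj₂ π-decomposes)) ⟩
        hasCandidate p 1 bs′ Y
          ≡⟨ no-candidate-markFalse d 1 bs Y fitsY d<falseCount ⟩
        false ∎
        where open ≡-Reasoning
      take-N : take N (excFlags 1 (φC σ d)) ≡ markFalse d bs
      take-N = begin
        take N (excFlags 1 (φC σ d))        ≡⟨ cong (take N) flags-π ⟩
        take N bs′                          ≡⟨ cong (λ k → take k bs′) (trans (length-markFalse d bs) length-flags) ⟨
        take (length (markFalse d bs)) bs′  ≡⟨ take-length-++ (markFalse d bs) [ false ] ⟩
        markFalse d bs                      ∎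
        where open ≡-Reasoning
      σ-recovered : proj₁ (ψC (φC σ d)) ≡ σ
      σ-recovered = begin
        interleave (unmarkTrue (indexOf n (EXCL (φC σ d))) (take N (excFlags 1 (φC σ d))))
                   (removeAt (indexOf n (EXCL (φC σ d))) (EXCL (φC σ d))) (NEXCL (φC σ d))
          ≡⟨ cong₂ (λ t bs″ → interleave (unmarkTrue t bs″) (removeAt t (EXCL (φC σ d))) (NEXCL (φC σ d))) indexOf-n take-N ⟩
        interleave (unmarkTrue slot (markFalse d bs)) (removeAt slot (EXCL (φC σ d))) (NEXCL (φC σ d))
          ≡⟨ cong₂ (λ bs″ X″ → interleave bs″ X″ (NEXCL (φC σ d))) (unmarkTrue-markFalse d bs d<falseCount)
                   (trans (cong (removeAt slot) EXCL-π) (removeAt-insertAt slot n X slot≤length)) ⟩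
        interleave bs X (NEXCL (φC σ d))
          ≡⟨ cong (interleave bs X) (proj₂ (proj₂ π-decomposes)) ⟩
        interleave bs X Y
          ≡⟨ interleave-EXCL-NEXCL 1 σ ⟩
        σ ∎
        where open ≡-Reasoning
      c-recovered : proj₂ (ψC (φC σ d)) ≡ c
      c-recovered = begin
        (length (EXCL (φC σ d)) ∸ 1) + g + falsesBefore (indexOf n (EXCL (φC σ d))) (excFlags 1 (φC σ d))
          ≡⟨ cong₂ (λ L t → (length L ∸ 1) + g + falsesBefore t (excFlags 1 (φC σ d))) EXCL-π indexOf-n ⟩
        (length X′ ∸ 1) + g + falsesBefore slot (excFlags 1 (φC σ d))
          ≡⟨ cong₂ (λ L bs″ → (L ∸ 1) + g + falsesBefore slot bs″) (length-insertAt slot n X) flags-π ⟩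
        length X + g + falsesBefore slot bs′
          ≡⟨ cong₂ (λ L k → L + g + k) (trans (FitsExc-length 1 bs X fitsX) (sym length-exclp)) (falsesBefore-markFalse d bs d<falseCount) ⟩
        e + g + d
          ≡⟨ solve-e+g+d e g d ⟩
        d + e + g
          ≡⟨ d+e+g≡c ⟩
        c ∎
        where
        open ≡-Reasoning
        solve-e+g+d : ∀ a b c → a + b + c ≡ c + a + b
        solve-e+g+d = solve-∀

    ψ-φC : ψ (φC σ d) ≡ (σ , c)
    ψ-φC = trans (ψ-C (φC σ d) n∉NEXCL no-candidate-φC) (cong₂ _,_ σ-recovered c-recovered)

  data Case (σ : List ℕ) (c : ℕ) : Set where
    caseA : c < g → Case σ c
    caseB : g ≤ c → c < length (exclp g h σ) + g → Case σ c
    caseC : length (exclp g h σ) + g ≤ c → Case σ c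

  case : ∀ σ c → Case σ c
  case σ c with c <? g | c <? length (exclp g h σ) + g
  ... | yes c<g | _ = caseA c<g
  ... | no c≮g | yes c<e+g = caseB (≮⇒≥ c≮g) c<e+g
  ... | no _ | no c≮e+g = caseC (≮⇒≥ c≮e+g)

  module Properties (1≤g : 1 ≤ g) (h≤n : h ≤ n) {σ c} (σ↭ : σ ↭ range N) (c<n : c < n) where

    φ-↭ : φ σ c ↭ range n
    φ-↭ with case σ c
    ... | caseA c<g = subst (_↭ range n) (sym (φ-A σ c c<g)) (CaseA.φA-↭ σ↭ c<g (s≤s⁻¹ c<n))
    ... | caseB g≤c c<e+g = subst (_↭ range n) (sym (φ-B σ c g≤c c<e+g)) (CaseB.φB-↭ h≤n σ↭ g≤c c<e+g)
    ... | caseC e+g≤c = subst (_↭ range n) (sym (φ-C σ c e+g≤c)) (CaseC.φC-↭ 1≤g h≤n σ↭ c<n e+g≤c)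

    ψ-φ : ψ (φ σ c) ≡ (σ , c)
    ψ-φ with case σ c
    ... | caseA c<g = trans (cong ψ (φ-A σ c c<g)) (CaseA.ψ-φA σ↭ c<g (s≤s⁻¹ c<n))
    ... | caseB g≤c c<e+g = trans (cong ψ (φ-B σ c g≤c c<e+g)) (CaseB.ψ-φB h≤n σ↭ g≤c c<e+g)
    ... | caseC e+g≤c = trans (cong ψ (φ-C σ c e+g≤c)) (CaseC.ψ-φC 1≤g h≤n σ↭ c<n e+g≤c)

    den-φ : den g h (φ σ c) ≡ den g h σ + c
    den-φ with case σ c
    ... | caseA c<g = trans (cong (den g h) (φ-A σ c c<g)) (CaseA.den-φA σ↭ c<g (s≤s⁻¹ c<n))
    ... | caseB g≤c c<e+g = trans (cong (den g h) (φ-B σ c g≤c c<e+g)) (CaseB.den-φB h≤n σ↭ g≤c c<e+g)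
    ... | caseC e+g≤c = trans (cong (den g h) (φ-C σ c e+g≤c)) (CaseC.den-φC 1≤g h≤n σ↭ c<n e+g≤c)

    private
      e : ℕ
      e = length (exclp g h σ)

      e+g≡suc : e + g ≡ suc (e + g ∸ 1)
      e+g≡suc = sym (m+[n∸m]≡n (≤-trans 1≤g (m≤n+m g e)))

      same : ∀ {S i} → S ≡ exclp g h σ → (i ∈ S) ⇔ (i ∈ exclp g h σ)
      same refl = mk⇔ (λ i∈ → i∈) (λ i∈ → i∈)

      one-more : ∀ {S p D i} → S ↭ p ∷ exclp g h σ → D ≡ just p → (i ∈ S) ⇔ (i ∈ exclp g h σ ⊎ D ≡ just i)
      one-more {S} {p} {D} {i} S↭ D≡ = mk⇔ to from
        where
        to : i ∈ S → i ∈ exclp g h σ ⊎ D ≡ just i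
        to i∈S with ∈-resp-↭ S↭ i∈S
        ... | here i≡p = inj₂ (trans D≡ (cong just (sym i≡p)))
        ... | there i∈ = inj₁ i∈
        from : i ∈ exclp g h σ ⊎ D ≡ just i → i ∈ S
        from (inj₁ i∈) = ∈-resp-↭ (↭-sym S↭) (there i∈)
        from (inj₂ D≡i) = ∈-resp-↭ (↭-sym S↭) (here (just-injective (trans (sym D≡i) D≡)))

    exclp-φ-kept : c ≤ e + g ∸ 1 → ∀ i → (i ∈ exclp g h (φ σ c)) ⇔ (i ∈ exclp g h σ)
    exclp-φ-kept c≤ i with case σ c
    ... | caseA c<g = same (trans (cong (exclp g h) (φ-A σ c c<g)) (CaseA.exclp-φA σ↭ c<g (s≤s⁻¹ c<n)))
    ... | caseB g≤c c<e+g = same (trans (cong (exclp g h) (φ-B σ c g≤c c<e+g)) (CaseB.exclp-φB h≤n σ↭ g≤c c<e+g))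
    ... | caseC e+g≤c = ⊥-elim (<-irrefl refl (≤-trans (subst (_≤ c) e+g≡suc e+g≤c) c≤))

    exclp-φ-grown : e + g ∸ 1 < c → ∀ i → (i ∈ exclp g h (φ σ c)) ⇔
                    (i ∈ exclp g h σ ⊎ dthSmallestNotIn N (exclp g h σ) (c ∸ e ∸ g + 1) ≡ just i)
    exclp-φ-grown e+g-1<c i with case σ c
    ... | caseA c<g = ⊥-elim (<⇒≱ c<g (≤-trans (m≤n+m g e) (subst (_≤ c) (sym e+g≡suc) e+g-1<c)))
    ... | caseB _ c<e+g = ⊥-elim (<⇒≱ c<e+g (subst (_≤ c) (sym e+g≡suc) e+g-1<c))
    ... | caseC e+g≤c = subst (λ π → (i ∈ exclp g h π) ⇔ (i ∈ exclp g h σ ⊎ dthSmallestNotIn N (exclp g h σ) (c ∸ e ∸ g + 1) ≡ just i))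
                          (sym (φ-C σ c e+g≤c))
                          (one-more (CaseC.exclp-φC 1≤g h≤n σ↭ c<n e+g≤c) (CaseC.dthSmallestNotIn-exclp 1≤g h≤n σ↭ c<n e+g≤c))

theorem4p1 : (g n h : ℕ) → 1 ≤ g → 1 ≤ n → 1 ≤ h → h ≤ n →
    Σ (List ℕ → ℕ → List ℕ) λ φ →
      -- φ maps S_{n-1} × {0,…,n-1} into S_n
      (∀ σ c → IsPerm (n ∸ 1) σ → c < n → IsPerm n (φ σ c))
      -- φ is injective on S_{n-1} × {0,…,n-1}
      × (∀ σ σ′ c c′ → IsPerm (n ∸ 1) σ → IsPerm (n ∸ 1) σ′ → c < n → c′ < n →
           φ σ c ≡ φ σ′ c′ → σ ≡ σ′ × c ≡ c′)
      -- φ is surjective onto S_n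
      × (∀ π → IsPerm n π → ∃ λ σ → ∃ λ c → IsPerm (n ∸ 1) σ × c < n × φ σ c ≡ π)
      -- statistics
      × (∀ σ c → IsPerm (n ∸ 1) σ → c < n →
           (c ≤ length (exclp g h σ) + g ∸ 1 →
              ∀ i → (i ∈ exclp g h (φ σ c)) ⇔ (i ∈ exclp g h σ))
         × (length (exclp g h σ) + g ∸ 1 < c →
              ∀ i → (i ∈ exclp g h (φ σ c)) ⇔
                    (i ∈ exclp g h σ
                     ⊎ dthSmallestNotIn (n ∸ 1) (exclp g h σ)
                         (c ∸ length (exclp g h σ) ∸ g + 1) ≡ just i))
         × den g h (φ σ c) ≡ den g h σ + c)
theorem4p1 g (suc N) h 1≤g _ _ h≤n =
  φ , (λ σ c σ↭ c<n → φ-↭ σ↭ c<n) , injective , (λ π → injective⇒surjective N φ φ-↭ (injective _ _ _ _))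
    , λ σ c σ↭ c<n → exclp-φ-kept σ↭ c<n , exclp-φ-grown σ↭ c<n , den-φ σ↭ c<n
  where
  open Construction g h N using (φ; ψ)
  open Construction.Properties g h N 1≤g h≤n
  injective : ∀ σ σ′ c c′ → σ ↭ range N → σ′ ↭ range N → c < suc N → c′ < suc N → φ σ c ≡ φ σ′ c′ → σ ≡ σ′ × c ≡ c′
  injective σ σ′ c c′ σ↭ σ′↭ c<n c′<n eq with trans (sym (ψ-φ σ↭ c<n)) (trans (cong ψ eq) (ψ-φ σ′↭ c′<n))
  ... | refl = refl , refl
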